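{- Let $n\ge1$, let $\mathcal{J}_n$ be the ideal of $\mathbb{Q}[x_1,\ldots,x_n]$ generated by all non-constant quasi-symmetric polynomials in $x_1,\ldots,x_n$, let $R_n=\mathbb{Q}[x_1,\ldots,x_n]/\mathcal{J}_n$, and let $SH_n=\mathcal{J}_n^{\perp}$ be the orthogonal complement of $\mathcal{J}_n$ with respect to the scalar product $\langle P,Q\rangle=\big(P(\partial_{x_1},\ldots,\partial_{x_n})Q\big)(0,\ldots,0)$. Then $$\dim SH_n=\dim R_n\le C_n=\frac{1}{n+1}\binom{2n}{n}.$$
   Context: For a composition $\alpha=[\alpha_1,\ldots,\alpha_k]$ of $d$ (finite sequence of positive integers with sum $d$) let $D(\alpha)=\{\alpha_1,\alpha_1+\alpha_2,\ldots,\alpha_1+\cdots+\alpha_{k-1}\}$ and $F_\alpha(x_1,\ldots,x_n)=\sum x_{j_1}\cdots x_{j_d}$ over $1\le j_1\le\cdots\le j_d\le n$ with $j_i<j_{i+1}$ whenever $i\in D(\alpha)$. Quasi-symmetric polynomials in $n$ variables are the $\mathbb{Q}$-span of these $F_\alpha(x_1,\ldots,x_n)$ (together with $1$); the non-constant ones are spanned by those with $d>0$. -}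

module Defs where

open import Data.Nat as ℕ using (ℕ; zero; suc; _<ᵇ_; _≤ᵇ_; _≡ᵇ_)
open import Data.Nat.Combinatorics using (_C_)
open import Data.Bool using (Bool; true; false; if_then_else_; _∧_)
open import Data.Fin using (Fin; toℕ)
open import Data.Fin.Properties using () renaming (_≟_ to _≟F_)
open import Data.List as L using (List; []; _∷_; _++_; concatMap; allFin; filter; filterᵇ)
open import Data.Bool.ListAction using (any)
open import Data.Nat.ListAction using (sum)
open import Data.List.Relation.Unary.All using (All)
open import Data.Vec as V using (Vec; lookup; updateAt; tabulate; zipWith)
open import Data.Vec.Properties using (≡-dec)
open import Data.Product using (Σ; ∃; ∃-syntax; _×_; _,_)
open import Data.Integer using (+_)
open import Data.Rational as Q using (ℚ; 0ℚ; 1ℚ; _/_)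
open import Relation.Nullary using (does)
open import Relation.Binary.PropositionalEquality using (_≡_)
open import Function using (_∘_)

-- A polynomial in n variables over ℚ: a finite formal sum of terms c·x^m,
-- m an exponent vector.  Representations are compared semantically (≈ₚ).
Poly : ℕ → Set
Poly n = List (ℚ × Vec ℕ n)

coeff : ∀ {n} → Poly n → Vec ℕ n → ℚ
coeff [] m = 0ℚ
coeff ((c , m′) ∷ P) m = if does (≡-dec ℕ._≟_ m′ m) then c Q.+ coeff P m else coeff P m

_≈ₚ_ : ∀ {n} → Poly n → Poly n → Set
P ≈ₚ R = ∀ m → coeff P m ≡ coeff R m

zeroP : ∀ {n} → Poly n
zeroP = []

_⊕_ : ∀ {n} → Poly n → Poly n → Poly n
P ⊕ R = P ++ R

scale : ∀ {n} → ℚ → Poly n → Poly n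
scale c = L.map (λ { (a , m) → (c Q.* a , m) })

negP : ∀ {n} → Poly n → Poly n
negP = scale (Q.- 1ℚ)

_⊗_ : ∀ {n} → Poly n → Poly n → Poly n
P ⊗ R = concatMap (λ { (a , m) → L.map (λ { (b , m′) → (a Q.* b , zipWith ℕ._+_ m m′) }) R }) P

lincomb : ∀ {n k} → Vec ℚ k → Vec (Poly n) k → Poly n
lincomb V.[] V.[] = zeroP
lincomb (c V.∷ cs) (b V.∷ bs) = scale c b ⊕ lincomb cs bs

IsComposition : List ℕ → Set
IsComposition α = All (λ a → 0 ℕ.< a) α

descents : List ℕ → List ℕ
descents [] = []
descents (a ∷ []) = []
descents (a ∷ b ∷ α) = a ∷ L.map (a ℕ.+_) (descents (b ∷ α))

seqs : (n d : ℕ) → List (List (Fin n))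
seqs n zero = [] ∷ []
seqs n (suc d) = concatMap (λ j → L.map (j ∷_) (seqs n d)) (allFin n)

-- validity of (j_i, j_{i+1}, …) where i is the (1-based) position of the head:
-- j_i ≤ j_{i+1}, strictly if i ∈ D
valid : ∀ {n} → List ℕ → ℕ → List (Fin n) → Bool
valid D i (a ∷ b ∷ js) =
  (if any (_≡ᵇ i) D then toℕ a <ᵇ toℕ b else toℕ a ≤ᵇ toℕ b) ∧ valid D (suc i) (b ∷ js)
valid D i _ = true

expo : ∀ {n} → List (Fin n) → Vec ℕ n
expo js = tabulate (λ k → L.length (filter (λ j → j ≟F k) js))

F : (n : ℕ) → List ℕ → Poly n
F n α = L.map (λ js → (1ℚ , expo js)) (filterᵇ (valid (descents α) 1) (seqs n (sum α)))

-- The ideal 𝒥ₙ generated by non-constant quasi-symmetric polynomials,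
-- i.e. by the F_α with |α| > 0.

NonConstComp : Set
NonConstComp = Σ (List ℕ) (λ α → IsComposition α × 0 ℕ.< sum α)

combo : ∀ {n} → List (Poly n × NonConstComp) → Poly n
combo [] = zeroP
combo {n} ((g , α , _) ∷ gs) = (g ⊗ F n α) ⊕ combo gs

InJ : (n : ℕ) → Poly n → Set
InJ n P = ∃[ gs ] (P ≈ₚ combo gs)

ℕtoℚ : ℕ → ℚ
ℕtoℚ k = + k / 1

deriv : ∀ {n} → Fin n → Poly n → Poly n
deriv i = L.map (λ { (c , m) → (c Q.* ℕtoℚ (lookup m i) , updateAt m i ℕ.pred) })

derivPow : ∀ {n} → Fin n → ℕ → Poly n → Poly n
derivPow i zero P = P
derivPow i (suc k) P = deriv i (derivPow i k P)

derivs : ∀ {n} → Vec ℕ n → Poly n → Poly n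
derivs {n} m R = L.foldr (λ i acc → derivPow i (lookup m i) acc) R (allFin n)

applyOp : ∀ {n} → Poly n → Poly n → Poly n
applyOp P R = concatMap (λ { (c , m) → scale c (derivs m R) }) P

evalAt0 : ∀ {n} → Poly n → ℚ
evalAt0 {n} R = coeff R (V.replicate n 0)

⟨_,_⟩ : ∀ {n} → Poly n → Poly n → ℚ
⟨ P , R ⟩ = evalAt0 (applyOp P R)

InSH : (n : ℕ) → Poly n → Set
InSH n R = ∀ P → InJ n P → ⟨ P , R ⟩ ≡ 0ℚ

-- b is a basis of Rₙ = ℚ[x]/𝒥ₙ (images linearly independent and spanning)
IsBasisR : ∀ n {k} → Vec (Poly n) k → Set
IsBasisR n b =
  (∀ cs → InJ n (lincomb cs b) → ∀ i → lookup cs i ≡ 0ℚ) ×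
  (∀ P → ∃[ cs ] InJ n (P ⊕ negP (lincomb cs b)))

IsBasisSH : ∀ n {k} → Vec (Poly n) k → Set
IsBasisSH n b =
  (∀ i → InSH n (lookup b i)) ×
  (∀ cs → lincomb cs b ≈ₚ zeroP → ∀ i → lookup cs i ≡ 0ℚ) ×
  (∀ R → InSH n R → ∃[ cs ] (R ≈ₚ lincomb cs b))

catalan : ℕ → ℕ
catalan n = ((2 ℕ.* n) C n) ℕ./ suc n

{-# OPTIONS --safe #-}
module Submission where

-- Splitting off the first variable gives
--   F_{(a+1)β}(x₁, …) = x₁ F_{aβ}(x₁, …) + F_{(a+1)β}(x₂, …),
-- where F_{0β}(x₁, …) stands for F_β(x₂, …).  Let w be exponents of the first k variables and α a
-- composition such that some partial sum of the word wα is at least its length.  Reading the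
-- recursion from right to left moves the last entry of w into the quasi-symmetric factor, and shows
-- by induction that x^w F_α(x_{k+1}, …, x_n) lies in 𝒥ₙ up to monomials whose first k exponents are
-- lexicographically smaller than w.  With k = n, every monomial whose exponent path crosses the
-- diagonal reduces modulo 𝒥ₙ to smaller ones of the same degree, so the monomials of Dyck paths
-- span Rₙ; all of them have degree < n.  Only finitely many relations between them are left, and
-- eliminating these one by one yields a monomial basis of Rₙ together with the dual functionals.
-- Under the scalar product the latter are a basis of SHₙ.

open import Defs
open import Data.Nat using (ℕ; _≤_)
open import Data.Vec using (Vec)
open import Data.Product using (Σ; ∃-syntax; _×_)

-- Ballot numbers

module Ballot where
  open import Data.Nat using (ℕ; zero; suc; _+_; _*_; _∸_; _/_; z≤n; s≤s)
  open import Data.Nat.Properties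
  open import Data.Nat.DivMod using (m*n/n≡m)
  open import Data.Nat.Combinatorics
  open import Data.Nat.Solver using (module +-*-Solver)
  open import Relation.Binary.PropositionalEquality
  open +-*-Solver

  -- The number of exponent vectors in `dyck n c`: for c > 0 the two summands correspond to a first
  -- exponent that is zero or positive.
  ballot : ℕ → ℕ → ℕ
  ballot zero    c       = 1
  ballot (suc n) zero    = ballot n 1
  ballot (suc n) (suc c) = ballot n (2 + c) + ballot (suc n) c

  pascal : ∀ n k → suc n C suc k ≡ n C k + n C suc k
  pascal n k = sym (nCk+nC[k+1]≡[n+1]C[k+1] n k)

  central : ∀ n {k} → k ≡ suc (n + n) → k C suc n ≡ k C n
  central n refl = trans (nCk≡nC[n∸k] (s≤s (m≤m+n n n))) (cong (suc (n + n) C_) (m+n∸m≡n n n))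

  -- The reflection principle ballot (n + 1) c = C(2n + 2 + c, n + 1) − C(2n + 2 + c, n).
  ballot-C : ∀ n c {k} → k ≡ 2 + (n + n + c) → ballot (suc n) c + k C n ≡ k C suc n
  ballot-C zero    zero    refl = refl
  ballot-C zero    (suc c) refl = begin
    suc (ballot 1 c) + (3 + c) C 0   ≡⟨ cong suc (ballot-C zero c refl) ⟩
    suc ((2 + c) C 1)                ≡⟨ pascal (2 + c) 0 ⟨
    (3 + c) C 1                      ∎
    where open ≡-Reasoning
  ballot-C (suc n) zero    refl = begin
    ballot (suc n) 1 + suc k C suc n
      ≡⟨ cong (ballot (suc n) 1 +_) (pascal k n) ⟩
    ballot (suc n) 1 + (k C n + k C suc n)
      ≡⟨ +-assoc (ballot (suc n) 1) _ _ ⟨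
    ballot (suc n) 1 + k C n + k C suc n
      ≡⟨ cong (_+ k C suc n) (ballot-C n 1
           (solve 1 (λ n → con 2 :+ n :+ (con 1 :+ n) :+ con 0 := con 2 :+ (n :+ n :+ con 1)) refl n)) ⟩
    k C suc n + k C suc n
      -- At c = 0 the recursion has a single summand. Here k = 2n + 3, and the equality of the two
      -- middle binomials supplies what Pascal's rule needs.
      ≡⟨ cong (k C suc n +_) (central (suc n) (+-identityʳ _)) ⟨
    k C suc n + k C suc (suc n)
      ≡⟨ pascal k (suc n) ⟨
    suc k C suc (suc n) ∎
    where
    open ≡-Reasoning
    k = 1 + (suc n + suc n + 0)
  ballot-C (suc n) (suc c) refl = begin
    ballot (suc n) (2 + c) + ballot (2 + n) c + suc k C suc n
      ≡⟨ cong (ballot (suc n) (2 + c) + ballot (2 + n) c +_) (pascal k n) ⟩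
    ballot (suc n) (2 + c) + ballot (2 + n) c + (k C n + k C suc n)
      ≡⟨ solve 4 (λ a b x y → a :+ b :+ (x :+ y) := a :+ x :+ (b :+ y)) refl
           (ballot (suc n) (2 + c)) (ballot (2 + n) c) (k C n) (k C suc n) ⟩
    ballot (suc n) (2 + c) + k C n + (ballot (2 + n) c + k C suc n)
      ≡⟨ cong₂ _+_ (ballot-C n (2 + c)
           (solve 2 (λ n c → con 2 :+ n :+ (con 1 :+ n) :+ (con 1 :+ c) := con 2 :+ (n :+ n :+ (con 2 :+ c))) refl n c))
           (ballot-C (suc n) c (cong suc (+-suc (suc n + suc n) c))) ⟩
    k C suc n + k C suc (suc n)
      ≡⟨ pascal k (suc n) ⟨
    suc k C suc (suc n) ∎
    where
    open ≡-Reasoning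
    k = 1 + (suc n + suc n + suc c)

  -- This is (k + 1) C(n, k + 1) = (n - k) C(n, k), arranged so that no truncated subtraction
  -- occurs.
  absorption : ∀ n k → suc k * (n C suc k) + k * (n C k) ≡ n * (n C k)
  absorption zero    zero    = refl
  absorption zero    (suc k) = cong₂ _+_ (*-zeroʳ k) (*-zeroʳ k)
  absorption (suc n) zero    = trans (cong (λ x → 1 * x + 0) (nC1≡n (suc n)))
    (solve 1 (λ n → con 1 :* (con 1 :+ n) :+ con 0 := (con 1 :+ n) :* con 1) refl n)
  absorption (suc n) (suc k) = begin
    (2 + k) * (suc n C (2 + k)) + (1 + k) * (suc n C suc k)
      ≡⟨ cong₂ (λ u v → (2 + k) * u + (1 + k) * v) (pascal n (suc k)) (pascal n k) ⟩
    (2 + k) * (y + z) + (1 + k) * (x + y)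
      ≡⟨ solve 4 (λ k x y z → (con 2 :+ k) :* (y :+ z) :+ (con 1 :+ k) :* (x :+ y) :=
           ((con 2 :+ k) :* z :+ (con 1 :+ k) :* y) :+ ((con 1 :+ k) :* y :+ k :* x) :+ (x :+ y)) refl k x y z ⟩
    ((2 + k) * z + (1 + k) * y) + ((1 + k) * y + k * x) + (x + y)
      ≡⟨ cong₂ (λ u v → u + v + (x + y)) (absorption n (suc k)) (absorption n k) ⟩
    n * y + n * x + (x + y)
      ≡⟨ solve 3 (λ n x y → n :* y :+ n :* x :+ (x :+ y) := (con 1 :+ n) :* (x :+ y)) refl n x y ⟩
    suc n * (x + y)
      ≡⟨ cong (suc n *_) (pascal n k) ⟨
    suc n * (suc n C suc k) ∎
    where
    open ≡-Reasoning
    x = n C k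
    y = n C suc k
    z = n C suc (suc k)

  -- By reflection b = N + a, and (n + 1) b = (n + 2) a. Subtracting the latter from (n + 2) b = (n
  -- + 2) N + (n + 2) a leaves b = (n + 2) N, so the division in `catalan` is exact.
  ballot-catalan : ∀ n → ballot (suc n) 0 ≡ catalan (suc n)
  ballot-catalan n = sym (begin
    ((2 * suc n) C suc n) / suc (suc n)
      ≡⟨ cong (λ x → (x C suc n) / suc (suc n)) (solve 1 (λ n → con 2 :* (con 1 :+ n) := con 2 :+ (n :+ n :+ con 0)) refl n) ⟩
    b / suc (suc n)                  ≡⟨ cong (_/ suc (suc n)) b≡ ⟩
    N * suc (suc n) / suc (suc n)    ≡⟨ m*n/n≡m N (suc (suc n)) ⟩
    N ∎)
    where
    open ≡-Reasoning
    k = 2 + (n + n + 0)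
    N = ballot (suc n) 0
    a = k C n
    b = k C suc n
    -- (n + 1) b = (n + 2) a, from absorption with k = 2 (n + 1).
    ratio : suc n * b ≡ suc (suc n) * a
    ratio = +-cancelʳ-≡ (n * a) _ _ (trans (absorption k n)
      (solve 2 (λ n a → (con 2 :+ (n :+ n :+ con 0)) :* a := (con 2 :+ n) :* a :+ n :* a) refl n a))
    b≡ : b ≡ N * suc (suc n)
    b≡ = +-cancelʳ-≡ (suc (suc n) * a) _ _ (begin
      b + suc (suc n) * a            ≡⟨ cong (b +_) ratio ⟨
      suc (suc n) * b                ≡⟨ cong (suc (suc n) *_) (ballot-C n 0 refl) ⟨
      suc (suc n) * (N + a)          ≡⟨ solve 3 (λ n N a → (con 2 :+ n) :* (N :+ a) := N :* (con 2 :+ n) :+ (con 2 :+ n) :* a) refl n N a ⟩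
      N * suc (suc n) + suc (suc n) * a ∎)

open import Algebra.Bundles using (module CommutativeRing)
open import Data.Bool using (true; false; if_then_else_; _∧_; _∨_)
open import Data.Bool.ListAction using (any)
import Data.Bool.Properties as Bₚ
open import Data.Empty using (⊥; ⊥-elim)
open import Data.Fin using (Fin; zero; suc; toℕ; punchIn)
open import Data.Fin.Properties using (¬∀⟶∃¬; all?) renaming (_≟_ to _≟F_)
open import Data.List as L using (List; []; _∷_; _++_)
open import Data.List.Membership.Propositional using (_∈_)
open import Data.List.Membership.Propositional.Properties using (∈-map⁺; ∈-++⁺ˡ; ∈-++⁺ʳ; ∈-cartesianProduct⁺)
import Data.List.Properties as Lₚ
open import Data.List.Relation.Unary.All as All using (All; []; _∷_)
import Data.List.Relation.Unary.All.Properties as Allₚ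
open import Data.List.Relation.Unary.Any as Any using (here; there)
open import Data.List.Relation.Unary.Any.Properties using (lookup-index)
open import Data.Nat as ℕ using (zero; suc; _∸_; z≤n; s≤s)
open import Data.Nat.Induction using (<-wellFounded)
open import Data.Nat.ListAction using (sum)
import Data.Nat.Properties as ℕₚ
open import Data.Product using (_,_; proj₁; proj₂; map₂)
open import Data.Product.Relation.Binary.Lex.Strict using (×-Lex; ×-wellFounded)
open import Data.Rational using (ℚ; 0ℚ; 1ℚ; _+_; _*_; -_; _-_; 1/_; ≢-nonZero; Positive)
open import Data.Rational.Properties as ℚₚ using (+-*-commutativeRing)
open import Data.Rational.Solver using (module +-*-Solver)
open import Data.Sum using (_⊎_; inj₁; inj₂; [_,_]′)
open import Data.Vec as V using ([]; _∷_)
import Data.Vec.Properties as Vₚ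
open import Function using (_∘_; id)
open import Induction.WellFounded using (Acc; acc; WellFounded)
import Relation.Binary.Construct.On as On
open import Relation.Binary.PropositionalEquality hiding (J)
open import Relation.Nullary using (Dec; yes; no; does)
open import Relation.Nullary.Decidable using (_×-dec_)
open import Algebra.Properties.Semiring.Sum (CommutativeRing.semiring +-*-commutativeRing)
  using (*-distribˡ-sum; *-distribʳ-sum; ∑-distrib-+; sum-cong-≗; sum-remove; sum-replicate-zero) renaming (sum to ∑)
open +-*-Solver using (solve; _:=_; _:+_; _:*_; :-_; _:-_; con)
open Ballot using (ballot; ballot-catalan)

-- Polynomials as linear functionals, and the ideal 𝒥ₙ

infix 4 _≋_

-- Polynomials are compared through their values under all linear functionals, which turns ⊕, scale,
-- ⊗ and reindexing of exponents into arithmetic in ℚ.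
ev : ∀ {n} → (Vec ℕ n → ℚ) → Poly n → ℚ
ev φ []            = 0ℚ
ev φ ((c , m) ∷ P) = c * φ m + ev φ P

_≋_ : ∀ {n} → Poly n → Poly n → Set
P ≋ R = ∀ φ → ev φ P ≡ ev φ R

mapExp : ∀ {n k} → (Vec ℕ n → Vec ℕ k) → Poly n → Poly k
mapExp h = L.map (map₂ h)

_⊞_ : ∀ {n} → Vec ℕ n → Vec ℕ n → Vec ℕ n
_⊞_ = V.zipWith ℕ._+_

mono : ∀ {n} → Vec ℕ n → Poly n
mono m = (1ℚ , m) ∷ []

-- `InJ n P` unfolds to a statement about coefficients, from which P cannot be inferred; the record
-- keeps P visible to unification. The same holds for `_~_`.
record J {n} (P : Poly n) : Set where
  constructor inJ
  field InJ-J : InJ n P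
open J public

infix 4 _~_
record _~_ {n} (P R : Poly n) : Set where
  constructor ~J
  field J-⊖ : J (P ⊕ negP R)
open _~_ public

-≡0⇒≡ : ∀ {x y} → x - y ≡ 0ℚ → x ≡ y
-≡0⇒≡ {x} {y} e = trans (solve 2 (λ x y → x := (x :- y) :+ y) refl x y) (trans (cong (_+ y) e) (ℚₚ.+-identityˡ y))

module _ {n : ℕ} where

  ev-++ : (φ : Vec ℕ n → ℚ) (P R : Poly n) → ev φ (P ++ R) ≡ ev φ P + ev φ R
  ev-++ φ []            R = sym (ℚₚ.+-identityˡ _)
  ev-++ φ ((c , m) ∷ P) R = trans (cong (c * φ m +_) (ev-++ φ P R)) (sym (ℚₚ.+-assoc (c * φ m) _ _))

  ev-scale : (φ : Vec ℕ n → ℚ) (c : ℚ) (P : Poly n) → ev φ (scale c P) ≡ c * ev φ P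
  ev-scale φ c []            = sym (ℚₚ.*-zeroʳ c)
  ev-scale φ c ((a , m) ∷ P) = trans (cong (c * a * φ m +_) (ev-scale φ c P))
    (solve 4 (λ c a f e → c :* a :* f :+ c :* e := c :* (a :* f :+ e)) refl c a (φ m) (ev φ P))

  ev-⊖ : (φ : Vec ℕ n → ℚ) (P R : Poly n) → ev φ (P ⊕ negP R) ≡ ev φ P - ev φ R
  ev-⊖ φ P R = trans (ev-++ φ P (negP R)) (cong (ev φ P +_)
    (trans (ev-scale φ (- 1ℚ) R) (solve 1 (λ x → con (- 1ℚ) :* x := :- x) refl (ev φ R))))

  ev-mono : (φ : Vec ℕ n → ℚ) (m : Vec ℕ n) → ev φ (mono m) ≡ φ m
  ev-mono φ m = trans (ℚₚ.+-identityʳ _) (ℚₚ.*-identityˡ _)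

  ev-mapExp : ∀ {k} (φ : Vec ℕ k → ℚ) (h : Vec ℕ n → Vec ℕ k) (P : Poly n) → ev φ (mapExp h P) ≡ ev (φ ∘ h) P
  ev-mapExp φ h []            = refl
  ev-mapExp φ h ((c , m) ∷ P) = cong (c * φ (h m) +_) (ev-mapExp φ h P)

  ev-cong : {φ ψ : Vec ℕ n → ℚ} → (∀ m → φ m ≡ ψ m) → ∀ P → ev φ P ≡ ev ψ P
  ev-cong e []            = refl
  ev-cong e ((c , m) ∷ P) = cong₂ (λ x y → c * x + y) (e m) (ev-cong e P)

  ev-cong-All : {S : Vec ℕ n → Set} {φ ψ : Vec ℕ n → ℚ} → (∀ m → S m → φ m ≡ ψ m) →
                ∀ P → All (S ∘ proj₂) P → ev φ P ≡ ev ψ P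
  ev-cong-All e []            []       = refl
  ev-cong-All e ((c , m) ∷ P) (s ∷ ss) = cong₂ (λ x y → c * x + y) (e m s) (ev-cong-All e P ss)

  ev-zero : (P : Poly n) → ev (λ _ → 0ℚ) P ≡ 0ℚ
  ev-zero []            = refl
  ev-zero ((c , m) ∷ P) = trans (cong (c * 0ℚ +_) (ev-zero P)) (solve 1 (λ c → c :* con 0ℚ :+ con 0ℚ := con 0ℚ) refl c)

  ev-*ˡ : (a : ℚ) (φ : Vec ℕ n → ℚ) (P : Poly n) → ev (λ m → a * φ m) P ≡ a * ev φ P
  ev-*ˡ a φ []            = sym (ℚₚ.*-zeroʳ a)
  ev-*ˡ a φ ((c , m) ∷ P) = trans (cong (c * (a * φ m) +_) (ev-*ˡ a φ P))
    (solve 4 (λ c a f e → c :* (a :* f) :+ a :* e := a :* (c :* f :+ e)) refl c a (φ m) (ev φ P))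

  ev-+ : (φ ψ : Vec ℕ n → ℚ) (P : Poly n) → ev (λ m → φ m + ψ m) P ≡ ev φ P + ev ψ P
  ev-+ φ ψ []            = refl
  ev-+ φ ψ ((c , m) ∷ P) = trans (cong (c * (φ m + ψ m) +_) (ev-+ φ ψ P))
    (solve 5 (λ c f g e d → c :* (f :+ g) :+ (e :+ d) := c :* f :+ e :+ (c :* g :+ d)) refl c (φ m) (ψ m) (ev φ P) (ev ψ P))

  ev-⊗ : (φ : Vec ℕ n → ℚ) (P R : Poly n) → ev φ (P ⊗ R) ≡ ev (λ m → ev (λ m′ → φ (m ⊞ m′)) R) P
  ev-⊗ φ []            R = refl
  ev-⊗ φ ((a , m) ∷ P) R = trans (ev-++ φ (L.map _ R) (P ⊗ R)) (cong₂ _+_ (row R) (ev-⊗ φ P R))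
    where
    row : ∀ R → ev φ (L.map (λ { (b , m′) → (a * b , V.zipWith ℕ._+_ m m′) }) R) ≡ a * ev (λ m′ → φ (m ⊞ m′)) R
    row []             = sym (ℚₚ.*-zeroʳ a)
    row ((b , m′) ∷ R) = trans (cong (a * b * φ (m ⊞ m′) +_) (row R))
      (solve 4 (λ c a f e → c :* a :* f :+ c :* e := c :* (a :* f :+ e)) refl a b (φ (m ⊞ m′)) _)

  δ : Vec ℕ n → Vec ℕ n → ℚ
  δ m m′ = if does (Vₚ.≡-dec ℕ._≟_ m′ m) then 1ℚ else 0ℚ

  coeff-ev : (P : Poly n) (m : Vec ℕ n) → coeff P m ≡ ev (δ m) P
  coeff-ev []             m = refl
  coeff-ev ((c , m′) ∷ P) m with does (Vₚ.≡-dec ℕ._≟_ m′ m)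
  ... | true  = cong₂ _+_ (sym (ℚₚ.*-identityʳ c)) (coeff-ev P m)
  ... | false = trans (coeff-ev P m) (solve 2 (λ c e → e := c :* con 0ℚ :+ e) refl c _)

  ≋⇒≈ : {P R : Poly n} → P ≋ R → P ≈ₚ R
  ≋⇒≈ {P} {R} e m = trans (coeff-ev P m) (trans (e (δ m)) (sym (coeff-ev R m)))

  without : Vec ℕ n → Poly n → Poly n
  without m []             = []
  without m ((c , m′) ∷ P) = if does (Vₚ.≡-dec ℕ._≟_ m′ m) then without m P else (c , m′) ∷ without m P

  length-without : ∀ m P → L.length (without m P) ℕ.≤ L.length P
  length-without m []             = ℕ.z≤n
  length-without m ((c , m′) ∷ P) with does (Vₚ.≡-dec ℕ._≟_ m′ m)
  ... | true  = ℕₚ.m≤n⇒m≤1+n (length-without m P)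
  ... | false = ℕ.s≤s (length-without m P)

  ev-without : ∀ φ m P → ev φ P ≡ coeff P m * φ m + ev φ (without m P)
  ev-without φ m []             = solve 1 (λ x → con 0ℚ := con 0ℚ :* x :+ con 0ℚ) refl (φ m)
  ev-without φ m ((c , m′) ∷ P) with Vₚ.≡-dec ℕ._≟_ m′ m
  ... | yes refl = trans (cong (c * φ m′ +_) (ev-without φ m P))
    (solve 4 (λ c f d e → c :* f :+ (d :* f :+ e) := (c :+ d) :* f :+ e) refl c (φ m) (coeff P m) _)
  ... | no _     = trans (cong (c * φ m′ +_) (ev-without φ m P))
    (solve 4 (λ c f d e → c :+ (d :* f :+ e) := d :* f :+ (c :+ e)) refl (c * φ m′) (φ m) (coeff P m) _)

  -- Removing all terms with the exponent m of the head takes away coeff P m · φ m = 0 and shortens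
  -- the list. The bound k on the length makes this induction structural.
  ≈0⇒≋0 : ∀ k (P : Poly n) → L.length P ℕ.≤ k → (∀ m → coeff P m ≡ 0ℚ) → ∀ φ → ev φ P ≡ 0ℚ
  ≈0⇒≋0 k       []              _        z φ = refl
  ≈0⇒≋0 (suc k) P@((c , m) ∷ P′) (ℕ.s≤s l) z φ = trans (ev-without φ m P)
    (trans (cong₂ (λ x y → x * φ m + y) (z m) (≈0⇒≋0 k (without m P) shorter vanish φ))
           (solve 1 (λ x → con 0ℚ :* x :+ con 0ℚ := con 0ℚ) refl (φ m)))
    where
    shorter : L.length (without m P) ℕ.≤ k
    shorter with Vₚ.≡-dec ℕ._≟_ m m
    ... | yes _  = ℕₚ.≤-trans (length-without m P′) l
    ... | no m≢m with () ← m≢m refl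
    vanish : ∀ m′ → coeff (without m P) m′ ≡ 0ℚ
    -- `ev-without` at the functional `δ m′` expresses coeff P m′ as coeff P m · δ m′ m plus the
    -- coefficient sought, and both coefficients of P vanish.
    vanish m′ = trans (coeff-ev (without m P) m′) (trans
      (solve 2 (λ d e → e := (con 0ℚ :* d :+ e)) refl (δ m′ m) _)
      (trans (cong (λ x → x * δ m′ m + ev (δ m′) (without m P)) (sym (z m)))
      (trans (sym (ev-without (δ m′) m P)) (trans (sym (coeff-ev P m′)) (z m′)))))

  ≈⇒≋ : {P R : Poly n} → P ≈ₚ R → P ≋ R
  ≈⇒≋ {P} {R} e φ = -≡0⇒≡ (trans (sym (ev-⊖ φ P R)) (≈0⇒≋0 _ (P ⊕ negP R) ℕₚ.≤-refl zeros φ))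
    where
    zeros : ∀ m → coeff (P ⊕ negP R) m ≡ 0ℚ
    zeros m = trans (coeff-ev (P ⊕ negP R) m) (trans (ev-⊖ (δ m) P R)
      (trans (cong₂ _-_ (trans (sym (coeff-ev P m)) (e m)) (sym (coeff-ev R m)))
             (ℚₚ.+-inverseʳ (coeff R m))))

  -- Closure properties of 𝒥ₙ and congruence modulo it

  J-≋ : {P R : Poly n} → P ≋ R → J P → J R
  J-≋ {P} {R} e (inJ (gs , h)) = inJ (gs , λ m → trans (sym (≋⇒≈ {P} {R} e m)) (h m))

  J-zero : J {n} []
  J-zero = inJ ([] , λ _ → refl)

  J-combo : ∀ {P : Poly n} gs → P ≋ combo gs → J P
  J-combo {P} gs e = inJ (gs , ≋⇒≈ {P} {combo gs} e)

  combo-++ : ∀ (gs hs : List (Poly n × NonConstComp)) → combo (gs ++ hs) ≡ combo gs ++ combo hs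
  combo-++ []                 hs = refl
  combo-++ ((g , α , _) ∷ gs) hs =
    trans (cong ((g ⊗ F n α) ++_) (combo-++ gs hs)) (sym (Lₚ.++-assoc (g ⊗ F n α) (combo gs) (combo hs)))

  J-⊕ : {P R : Poly n} → J P → J R → J (P ⊕ R)
  J-⊕ {P} {R} (inJ (gs , g)) (inJ (hs , h)) = J-combo (gs ++ hs) λ φ →
    trans (ev-++ φ P R) (trans (cong₂ _+_ (≈⇒≋ {P} {combo gs} g φ) (≈⇒≋ {R} {combo hs} h φ))
      (trans (sym (ev-++ φ (combo gs) (combo hs))) (cong (ev φ) (sym (combo-++ gs hs)))))

  module _ (T : Poly n → Poly n) (τ : (Vec ℕ n → ℚ) → Vec ℕ n → ℚ)
           (ev-T : ∀ φ P → ev φ (T P) ≡ ev (τ φ) P)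
           (T-⊗ : ∀ g R → T (g ⊗ R) ≋ (T g ⊗ R)) where

    -- T is linear, with transpose τ, and commutes with multiplication on the right, so on a
    -- combination of generators it can act on the cofactors alone. Scalars and monomial factors are
    -- both of this kind.
    J-map : {P : Poly n} → J P → J (T P)
    J-map {P} (inJ (gs , g)) = J-combo (T* gs) λ φ →
      trans (ev-T φ P) (trans (≈⇒≋ {P} {combo gs} g (τ φ)) (trans (sym (ev-T φ (combo gs))) (T-combo gs φ)))
      where
      T* : List (Poly n × NonConstComp) → List (Poly n × NonConstComp)
      T* = L.map λ (h , α) → T h , α
      T-combo : ∀ gs → T (combo gs) ≋ combo (T* gs)
      T-combo []                 φ = ev-T φ []
      T-combo ((h , α , _) ∷ gs) φ = trans (ev-T φ _) (trans (ev-++ (τ φ) (h ⊗ F n α) (combo gs))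
        (trans (cong₂ _+_ (trans (sym (ev-T φ (h ⊗ F n α))) (T-⊗ h (F n α) φ))
                          (trans (sym (ev-T φ (combo gs))) (T-combo gs φ)))
               (sym (ev-++ φ (T h ⊗ F n α) _))))

  J-scale : ∀ c {P : Poly n} → J P → J (scale c P)
  J-scale c = J-map (scale c) (λ φ m → c * φ m) (λ φ P → trans (ev-scale φ c P) (sym (ev-*ˡ c φ P)))
    (λ g R φ → trans (ev-scale φ c (g ⊗ R)) (trans (cong (c *_) (ev-⊗ φ g R))
      (trans (sym (ev-scale _ c g)) (sym (ev-⊗ φ (scale c g) R)))))

  J-shift : ∀ u {P : Poly n} → J P → J (mapExp (u ⊞_) P)
  J-shift u = J-map (mapExp (u ⊞_)) (λ φ m → φ (u ⊞ m)) (λ φ P → ev-mapExp φ (u ⊞_) P)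
    (λ g R φ → trans (ev-mapExp φ (u ⊞_) (g ⊗ R)) (trans (ev-⊗ _ g R)
      (trans (ev-cong (λ m → ev-cong (λ m′ → cong φ (sym (Vₚ.zipWith-assoc ℕₚ.+-assoc u m m′))) R) g)
      (trans (sym (ev-mapExp _ (u ⊞_) g)) (sym (ev-⊗ φ (mapExp (u ⊞_) g) R))))))

  zeros : Vec ℕ n
  zeros = V.replicate n 0

  zeros-⊞ : ∀ m → zeros ⊞ m ≡ m
  zeros-⊞ = Vₚ.zipWith-identityˡ ℕₚ.+-identityˡ

  J-F : ∀ α → IsComposition α → 0 ℕ.< sum α → J (F n α)
  J-F α c p = J-combo ((mono zeros , α , c , p) ∷ []) λ φ → sym
    (trans (ev-++ φ (mono zeros ⊗ F n α) []) (trans (ℚₚ.+-identityʳ _)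
    (trans (ev-⊗ φ (mono zeros) (F n α)) (trans (ev-mono (λ m → ev (λ m′ → φ (m ⊞ m′)) (F n α)) zeros)
      (ev-cong (λ m → cong φ (zeros-⊞ m)) (F n α))))))

  ≋⇒~ : {P R : Poly n} → P ≋ R → P ~ R
  ≋⇒~ {P} {R} e = ~J (J-≋ (λ φ → sym (trans (ev-⊖ φ P R)
    (trans (cong (_- ev φ R) (e φ)) (ℚₚ.+-inverseʳ (ev φ R))))) J-zero)

  ~-sym : {P R : Poly n} → P ~ R → R ~ P
  ~-sym {P} {R} (~J h) = ~J (J-≋ (λ φ → trans (ev-scale φ (- 1ℚ) (P ⊕ negP R))
    (trans (cong (- 1ℚ *_) (ev-⊖ φ P R)) (trans
      (solve 2 (λ p r → con (- 1ℚ) :* (p :- r) := r :- p) refl (ev φ P) (ev φ R)) (sym (ev-⊖ φ R P)))))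
    (J-scale (- 1ℚ) h))

  ~-trans : {P R S : Poly n} → P ~ R → R ~ S → P ~ S
  ~-trans {P} {R} {S} (~J h) (~J k) = ~J (J-≋ (λ φ → trans (ev-++ φ (P ⊕ negP R) _)
    (trans (cong₂ _+_ (ev-⊖ φ P R) (ev-⊖ φ R S)) (trans
      (solve 3 (λ p r s → p :- r :+ (r :- s) := p :- s) refl (ev φ P) (ev φ R) (ev φ S)) (sym (ev-⊖ φ P S)))))
    (J-⊕ h k))

  ~-⊕ : {P R P′ R′ : Poly n} → P ~ R → P′ ~ R′ → (P ⊕ P′) ~ (R ⊕ R′)
  ~-⊕ {P} {R} {P′} {R′} (~J h) (~J k) = ~J (J-≋ (λ φ →
    trans (ev-++ φ (P ⊕ negP R) _) (trans (cong₂ _+_ (ev-⊖ φ P R) (ev-⊖ φ P′ R′)) (trans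
      (solve 4 (λ p r p′ r′ → p :- r :+ (p′ :- r′) := (p :+ p′) :- (r :+ r′)) refl (ev φ P) (ev φ R) (ev φ P′) (ev φ R′))
      (sym (trans (ev-⊖ φ (P ⊕ P′) (R ⊕ R′)) (cong₂ _-_ (ev-++ φ P P′) (ev-++ φ R R′)))))))
    (J-⊕ h k))

  ~-scale : ∀ c {P R : Poly n} → P ~ R → scale c P ~ scale c R
  ~-scale c {P} {R} (~J h) = ~J (J-≋ (λ φ →
    trans (ev-scale φ c (P ⊕ negP R)) (trans (cong (c *_) (ev-⊖ φ P R)) (trans
      (solve 3 (λ c p r → c :* (p :- r) := c :* p :- c :* r) refl c (ev φ P) (ev φ R))
      (sym (trans (ev-⊖ φ (scale c P) (scale c R)) (cong₂ _-_ (ev-scale φ c P) (ev-scale φ c R)))))))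
    (J-scale c h))

  ~-shift : ∀ u {P R : Poly n} → P ~ R → mapExp (u ⊞_) P ~ mapExp (u ⊞_) R
  ~-shift u {P} {R} (~J h) = ~J (J-≋ (λ φ →
    trans (ev-mapExp φ _ (P ⊕ negP R)) (trans (ev-⊖ _ P R) (sym (trans (ev-⊖ φ (mapExp (u ⊞_) P) _)
      (cong₂ _-_ (ev-mapExp φ _ P) (ev-mapExp φ _ R))))))
    (J-shift u h))

  J-~ : {P R : Poly n} → P ~ R → J R → J P
  J-~ {P} {R} (~J h) r = J-≋ (λ φ → trans (ev-++ φ (P ⊕ negP R) R)
    (trans (cong (_+ ev φ R) (ev-⊖ φ P R)) (solve 2 (λ p r → p :- r :+ r := p) refl (ev φ P) (ev φ R))))
    (J-⊕ h r)

  ~-refl : {P : Poly n} → P ~ P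
  ~-refl {P} = ≋⇒~ {P} {P} λ _ → refl

-- The recursion for fundamental quasi-symmetric polynomials

-- On exponents this is multiplication by x₁; likewise `0 ∷_` includes the polynomials in x₂, ...
-- into those in x₁, ....
incr : ∀ {n} → Vec ℕ (suc n) → Vec ℕ (suc n)
incr (e ∷ m) = suc e ∷ m

-- Fundamental quasi-symmetric polynomials by recursion on the first variable.  Allowing a leading
-- part 0, with Q (suc n) (0 ∷ β) not involving the first variable, makes the recursion uniform.
Q : ∀ n → List ℕ → Poly n
Q n       []          = mono zeros
Q zero    (zero ∷ β)  = Q zero β
Q zero    (suc a ∷ β) = []
Q (suc n) (zero ∷ β)  = mapExp (0 ∷_) (Q n β)
Q (suc n) (suc a ∷ β) = mapExp incr (Q (suc n) (a ∷ β)) ⊕ mapExp (0 ∷_) (Q n (suc a ∷ β))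

-- Sums over index sequences

∑seqs : ∀ n → ℕ → (List (Fin n) → ℚ) → ℚ
∑seqs n zero    g = g []
∑seqs n (suc d) g = ∑ λ j → ∑seqs n d (λ js → g (j ∷ js))

∑seqs-cong : ∀ {n} d {g h : List (Fin n) → ℚ} → (∀ js → g js ≡ h js) → ∑seqs n d g ≡ ∑seqs n d h
∑seqs-cong zero    e = e []
∑seqs-cong (suc d) e = sum-cong-≗ λ j → ∑seqs-cong d (λ js → e (j ∷ js))

∑seqs-zero : ∀ {n} d {g : List (Fin n) → ℚ} → (∀ js → g js ≡ 0ℚ) → ∑seqs n d g ≡ 0ℚ
∑seqs-zero     zero    e = e []
∑seqs-zero {n} (suc d) e = trans (sum-cong-≗ λ j → ∑seqs-zero d (λ js → e (j ∷ js))) (sum-replicate-zero n)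

-- This is the passage from the variables x₁, ... to x₂, ...: only sequences that avoid x₁ can
-- contribute.
∑seqs-suc : ∀ {n} d {g : List (Fin (suc n)) → ℚ} → (∀ js → zero ∈ js → g js ≡ 0ℚ) →
            ∑seqs (suc n) d g ≡ ∑seqs n d (g ∘ L.map suc)
∑seqs-suc zero    z = refl
∑seqs-suc (suc d) z = trans (cong₂ _+_ (∑seqs-zero d λ js → z (zero ∷ js) (here refl))
                                       (sum-cong-≗ λ j → ∑seqs-suc d λ js 0∈ → z (suc j ∷ js) (there 0∈)))
                            (ℚₚ.+-identityˡ _)

∑list : ∀ {A : Set} → (A → ℚ) → List A → ℚ
∑list g []       = 0ℚ
∑list g (x ∷ xs) = g x + ∑list g xs

∑list-++ : ∀ {A : Set} (g : A → ℚ) xs ys → ∑list g (xs ++ ys) ≡ ∑list g xs + ∑list g ys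
∑list-++ g []       ys = sym (ℚₚ.+-identityˡ _)
∑list-++ g (x ∷ xs) ys = trans (cong (g x +_) (∑list-++ g xs ys)) (sym (ℚₚ.+-assoc (g x) _ _))

∑list-map : ∀ {A B : Set} (g : B → ℚ) (f : A → B) xs → ∑list g (L.map f xs) ≡ ∑list (g ∘ f) xs
∑list-map g f []       = refl
∑list-map g f (x ∷ xs) = cong (g (f x) +_) (∑list-map g f xs)

∑list-concatMap-tabulate : ∀ {A B : Set} {k} (g : B → ℚ) (f : A → List B) (h : Fin k → A) →
                           ∑list g (L.concatMap f (L.tabulate h)) ≡ ∑ (λ j → ∑list g (f (h j)))
∑list-concatMap-tabulate {k = zero}  g f h = refl
∑list-concatMap-tabulate {k = suc k} g f h = trans (∑list-++ g (f (h zero)) _)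
  (cong (∑list g (f (h zero)) +_) (∑list-concatMap-tabulate g f (h ∘ suc)))

∑list-seqs : ∀ n d (g : List (Fin n) → ℚ) → ∑list g (seqs n d) ≡ ∑seqs n d g
∑list-seqs n zero    g = ℚₚ.+-identityʳ _
∑list-seqs n (suc d) g = trans (∑list-concatMap-tabulate g (λ j → L.map (j ∷_) (seqs n d)) id)
  (sum-cong-≗ λ j → trans (∑list-map g (j ∷_) (seqs n d)) (∑list-seqs n d _))

weight : ∀ {n} → List ℕ → ℕ → (Vec ℕ n → ℚ) → List (Fin n) → ℚ
weight D i φ js = if valid D i js then φ (expo js) else 0ℚ

ev-F : ∀ n α φ → ev φ (F n α) ≡ ∑seqs n (sum α) (weight (descents α) 1 φ)
ev-F n α φ = trans (go (seqs n (sum α))) (∑list-seqs n (sum α) _)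
  where
  go : ∀ xs → ev φ (L.map (λ js → (1ℚ , expo js)) (L.filterᵇ (valid (descents α) 1) xs)) ≡
              ∑list (weight (descents α) 1 φ) xs
  go []        = refl
  go (js ∷ xs) with valid (descents α) 1 js
  ... | true  = cong₂ _+_ (ℚₚ.*-identityˡ (φ (expo js))) (go xs)
  ... | false = trans (go xs) (sym (ℚₚ.+-identityˡ _))

expo-suc : ∀ {n} (js : List (Fin n)) → expo (L.map suc js) ≡ 0 ∷ expo js
expo-suc js = cong₂ _∷_ (none js) (Vₚ.tabulate-cong (same js))
  where
  none : ∀ {n} (js : List (Fin n)) → L.length (L.filter (_≟F zero) (L.map suc js)) ≡ 0
  none []       = refl
  none (j ∷ js) = none js
  same : ∀ {n} (js : List (Fin n)) k →
         L.length (L.filter (_≟F suc k) (L.map suc js)) ≡ L.length (L.filter (_≟F k) js)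
  same []       k = refl
  same (j ∷ js) k with does (j ≟F k)
  ... | true  = cong suc (same js k)
  ... | false = same js k

expo-[] : ∀ n → expo {n} [] ≡ zeros
expo-[] zero    = refl
expo-[] (suc n) = cong (0 ∷_) (expo-[] n)

any-map-suc : ∀ i D → any (ℕ._≡ᵇ suc i) (L.map suc D) ≡ any (ℕ._≡ᵇ i) D
any-map-suc i []      = refl
any-map-suc i (x ∷ D) = cong ((x ℕ.≡ᵇ i) ∨_) (any-map-suc i D)

valid-map-suc : ∀ {n} D i (js : List (Fin n)) → valid (L.map suc D) (suc i) js ≡ valid D i js
valid-map-suc D i []           = refl
valid-map-suc D i (j ∷ [])     = refl
valid-map-suc D i (a ∷ b ∷ js) =
  cong₂ (λ d v → (if d then toℕ a ℕ.<ᵇ toℕ b else toℕ a ℕ.≤ᵇ toℕ b) ∧ v)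
        (any-map-suc i D) (valid-map-suc D (suc i) (b ∷ js))

-- Only positions from 1 on are tested, so a descent at 0 has no effect.
valid-0∷ : ∀ {n} D i (js : List (Fin n)) → valid (0 ∷ D) (suc i) js ≡ valid D (suc i) js
valid-0∷ D i []           = refl
valid-0∷ D i (j ∷ [])     = refl
valid-0∷ D i (a ∷ b ∷ js) = cong (_ ∧_) (valid-0∷ D (suc i) (b ∷ js))

valid-lift : ∀ {n} D i (js : List (Fin n)) → valid D i (L.map suc js) ≡ valid D i js
valid-lift D i []           = refl
valid-lift D i (j ∷ [])     = refl
valid-lift D i (a ∷ b ∷ js) =
  cong₂ (λ l v → (if any (ℕ._≡ᵇ i) D then toℕ a ℕ.<ᵇ toℕ b else l) ∧ v)
        (≤ᵇ-suc (toℕ a)) (valid-lift D (suc i) (b ∷ js))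
  where
  ≤ᵇ-suc : ∀ x {y} → (suc x ℕ.≤ᵇ suc y) ≡ (x ℕ.≤ᵇ y)
  ≤ᵇ-suc zero    = refl
  ≤ᵇ-suc (suc x) = refl

-- Where the sequence first returns to `zero` its predecessor is positive, and there the strict and
-- the weak comparison both fail.
valid-suc-zero : ∀ {n} D i (j : Fin n) js → zero ∈ js → valid D i (suc j ∷ js) ≡ false
valid-suc-zero D i j (zero ∷ js)  _          with any (ℕ._≡ᵇ i) D
... | true  = refl
... | false = refl
valid-suc-zero D i j (suc k ∷ js) (there 0∈) = trans (cong (_ ∧_) (valid-suc-zero D (suc i) k js 0∈)) (Bₚ.∧-zeroʳ _)

descents-suc : ∀ a β → descents (suc a ∷ β) ≡ L.map suc (descents (a ∷ β))
descents-suc a []      = refl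
descents-suc a (b ∷ β) = cong (suc a ∷_) (Lₚ.map-∘ (descents (b ∷ β)))

0∉descents : ∀ a β → any (ℕ._≡ᵇ 0) (descents (suc a ∷ β)) ≡ false
0∉descents a []      = refl
0∉descents a (b ∷ β) = go (descents (b ∷ β))
  where
  go : ∀ D → any (ℕ._≡ᵇ 0) (L.map (suc a ℕ.+_) D) ≡ false
  go []      = refl
  go (x ∷ D) = go D

-- By `ev-F` this is the value of φ on F_α, in a form where the first index can be split off.
E : ∀ n → List ℕ → (Vec ℕ n → ℚ) → ℚ
E n α φ = ∑seqs n (sum α) (weight (descents α) 1 φ)

-- If j₁ is not x₁, monotonicity excludes x₁ from the whole sequence.
E-later : ∀ n a β φ → ∑ (λ j → ∑seqs (suc n) (a ℕ.+ sum β) (λ js → weight (descents (suc a ∷ β)) 1 φ (suc j ∷ js))) ≡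
          E n (suc a ∷ β) (φ ∘ (0 ∷_))
E-later n a β φ = sum-cong-≗ λ j → trans
  (∑seqs-suc (a ℕ.+ sum β) (λ js 0∈ → cong (if_then φ (expo (suc j ∷ js)) else 0ℚ) (valid-suc-zero D 1 j js 0∈)))
  (∑seqs-cong (a ℕ.+ sum β) λ js → cong₂ (λ b x → if b then φ x else 0ℚ) (valid-lift D 1 (j ∷ js)) (expo-suc (j ∷ js)))
  where D = descents (suc a ∷ β)

E-first : ∀ n a β φ → ∑seqs (suc n) (suc a ℕ.+ sum β) (λ js → weight (descents (suc (suc a) ∷ β)) 1 φ (zero ∷ js)) ≡
          E (suc n) (suc a ∷ β) (φ ∘ incr)
E-first n a β φ = ∑seqs-cong (suc a ℕ.+ sum β) λ js → cong (if_then φ (incr (expo js)) else 0ℚ)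
  (trans (cong (λ D → valid D 1 (zero ∷ js)) (descents-suc (suc a) β)) (skip js))
  where
  D = descents (suc a ∷ β)
  skip : ∀ js → valid (L.map suc D) 1 (zero {n} ∷ js) ≡ valid D 1 js
  skip []       = refl
  -- The first part is at least 2, so no descent separates the removed index from the next one; what
  -- remains to compare is 0 ≤ b, which always holds.
  skip (b ∷ js) rewrite any-map-suc 0 D | 0∉descents a β = valid-map-suc D 1 (b ∷ js)

-- With first part 1 there is a descent right after j₁ = x₁, hence all later indices exceed x₁ and
-- form F_β(x₂, ...).
E-first-1 : ∀ n β φ → ∑seqs (suc n) (sum β) (λ js → weight (descents (1 ∷ β)) 1 φ (zero ∷ js)) ≡
            E n β (φ ∘ incr ∘ (0 ∷_))
E-first-1 n []      φ = cong (φ ∘ incr) (expo-suc [])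
E-first-1 n (b ∷ β) φ = trans (∑seqs-suc (b ℕ.+ sum β) (λ js 0∈ → cong (if_then φ (expo (zero ∷ js)) else 0ℚ) (vanish js 0∈)))
  (∑seqs-cong (b ℕ.+ sum β) λ js → cong₂ (λ b x → if b then φ x else 0ℚ) (val js) (cong incr (expo-suc js)))
  where
  D = descents (b ∷ β)
  vanish : ∀ js → zero ∈ js → valid (descents (1 ∷ b ∷ β)) 1 (zero ∷ js) ≡ false
  vanish (zero ∷ js)  _          = refl
  vanish (suc j ∷ js) (there 0∈) = valid-suc-zero _ 2 j js 0∈
  val : ∀ js → valid (descents (1 ∷ b ∷ β)) 1 (zero {n} ∷ L.map suc js) ≡ valid D 1 js
  val []       = refl
  -- The descents of 1 ∷ b ∷ β are those of b ∷ β together with 0, all shifted by one.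
  val (j ∷ js) = trans (valid-lift _ 2 (j ∷ js)) (trans (valid-map-suc (0 ∷ D) 1 (j ∷ js)) (valid-0∷ D 0 (j ∷ js)))

-- The terms with j₁ = x₁ and those with j₁ > x₁ give the two summands of `Q`. A first part 1 is
-- treated separately because lowering it leaves the part 0, that is, a factor without x₁.
E-Q : ∀ n α → IsComposition α → ∀ φ → E n α φ ≡ ev φ (Q n α)
E-Q n       []                _       φ = trans (cong φ (expo-[] n)) (sym (ev-mono φ zeros))
E-Q zero    (zero ∷ β)        (() ∷ _)
E-Q zero    (suc a ∷ β)       _       φ = refl
E-Q (suc n) (suc zero ∷ β)    (p ∷ c) φ = trans
  (cong₂ _+_ (trans (E-first-1 n β φ) (trans (E-Q n β c _)
               (sym (trans (ev-mapExp φ incr (Q (suc n) (0 ∷ β))) (ev-mapExp _ (0 ∷_) (Q n β))))))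
             (trans (E-later n 0 β φ) (trans (E-Q n (1 ∷ β) (p ∷ c) _) (sym (ev-mapExp φ (0 ∷_) (Q n (1 ∷ β)))))))
  (sym (ev-++ φ (mapExp incr (Q (suc n) (0 ∷ β))) _))
E-Q (suc n) (suc (suc a) ∷ β) (p ∷ c) φ = trans
  (cong₂ _+_ (trans (E-first n a β φ) (trans (E-Q (suc n) (suc a ∷ β) (ℕ.s≤s ℕ.z≤n ∷ c) _)
               (sym (ev-mapExp φ incr (Q (suc n) (suc a ∷ β))))))
             (trans (E-later n (suc a) β φ) (trans (E-Q n (suc (suc a) ∷ β) (p ∷ c) _)
               (sym (ev-mapExp φ (0 ∷_) (Q n (suc (suc a) ∷ β)))))))
  (sym (ev-++ φ (mapExp incr (Q (suc n) (suc a ∷ β))) _))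

F≋Q : ∀ n α → IsComposition α → F n α ≋ Q n α
F≋Q n α c φ = trans (ev-F n α φ) (E-Q n α c φ)

-- Monomials below the diagonal span Rₙ

deg : ∀ {n} → Vec ℕ n → ℕ
deg = V.sum

deg-zeros : ∀ n → deg (zeros {n}) ≡ 0
deg-zeros zero    = refl
deg-zeros (suc n) = deg-zeros n

deg-⊞ : ∀ {n} (u m : Vec ℕ n) → deg (u ⊞ m) ≡ deg u ℕ.+ deg m
deg-⊞ []      []      = refl
deg-⊞ (x ∷ u) (y ∷ m) = trans (cong (x ℕ.+ y ℕ.+_) (deg-⊞ u m)) (ℕ+-interchange x y (deg u) (deg m))
  where
  ℕ+-interchange : ∀ a b c d → a ℕ.+ b ℕ.+ (c ℕ.+ d) ≡ a ℕ.+ c ℕ.+ (b ℕ.+ d)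
  ℕ+-interchange a b c d = trans (ℕₚ.+-assoc a b (c ℕ.+ d)) (trans (cong (a ℕ.+_)
    (trans (sym (ℕₚ.+-assoc b c d)) (trans (cong (ℕ._+ d) (ℕₚ.+-comm b c)) (ℕₚ.+-assoc c b d))))
    (sym (ℕₚ.+-assoc a c (b ℕ.+ d))))

AllExp : ∀ {n} → (Vec ℕ n → Set) → Poly n → Set
AllExp S = All (S ∘ proj₂)

AllExp-map : ∀ {n k} {S : Vec ℕ n → Set} {S′ : Vec ℕ k → Set} {h : Vec ℕ n → Vec ℕ k} →
             (∀ {m} → S m → S′ (h m)) → ∀ {P} → AllExp S P → AllExp S′ (mapExp h P)
AllExp-map f = Allₚ.map⁺ ∘ All.map f

AllExp-scale : ∀ {n} {S : Vec ℕ n → Set} c {P} → AllExp S P → AllExp S (scale c P)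
AllExp-scale c = Allₚ.map⁺ ∘ All.map id

deg-incr : ∀ {n} (m : Vec ℕ (suc n)) → deg (incr m) ≡ suc (deg m)
deg-incr (e ∷ m) = refl

Q-deg : ∀ n α → AllExp (λ m → deg m ≡ sum α) (Q n α)
Q-deg n       []          = deg-zeros n ∷ []
Q-deg zero    (zero ∷ β)  = Q-deg zero β
Q-deg zero    (suc a ∷ β) = []
Q-deg (suc n) (zero ∷ β)  = AllExp-map id (Q-deg n β)
Q-deg (suc n) (suc a ∷ β) = Allₚ.++⁺
  (AllExp-map (λ {m} e → trans (deg-incr m) (cong suc e)) (Q-deg (suc n) (a ∷ β)))
  (AllExp-map id (Q-deg n (suc a ∷ β)))

-- Unrolling the recursion e times along its first summand ends in x₁^e times `Q r α` in the later
-- variables. The other summands split off on the way carry fewer than e factors x₁.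
Q-lead : ∀ r e α → ∃[ L ] (Q (suc r) (e ∷ α) ≋ (mapExp (e ∷_) (Q r α) ⊕ L) ×
                           AllExp (λ m → V.head m ℕ.< e × deg m ≡ e ℕ.+ sum α) L)
Q-lead r zero    α = [] , (λ φ → sym (trans (ev-++ φ (mapExp (0 ∷_) (Q r α)) []) (ℚₚ.+-identityʳ _))) , []
Q-lead r (suc e) α with L , eq , low ← Q-lead r e α =
  mapExp incr L ⊕ mapExp (0 ∷_) (Q r (suc e ∷ α)) ,
  (λ φ → trans (ev-++ φ (mapExp incr (Q (suc r) (e ∷ α))) T)
    (trans (cong (_+ ev φ T) (trans (ev-mapExp φ incr (Q (suc r) (e ∷ α))) (trans (eq _)
      (trans (ev-++ _ (mapExp (e ∷_) (Q r α)) L) (cong₂ _+_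
        (trans (ev-mapExp _ (e ∷_) (Q r α)) (sym (ev-mapExp φ (suc e ∷_) (Q r α))))
        (sym (ev-mapExp φ incr L)))))))
    (trans (ℚₚ.+-assoc (ev φ (mapExp (suc e ∷_) (Q r α))) _ _) (trans
      (cong (ev φ (mapExp (suc e ∷_) (Q r α)) +_) (sym (ev-++ φ (mapExp incr L) T)))
      (sym (ev-++ φ (mapExp (suc e ∷_) (Q r α)) _)))))) ,
  Allₚ.++⁺ (AllExp-map (λ { {x ∷ m} (lt , d) → s≤s lt , cong suc d }) low)
           (AllExp-map (λ d → s≤s z≤n , d) (Q-deg r (suc e ∷ α)))
  where T = mapExp (0 ∷_) (Q r (suc e ∷ α))

-- Linear spans modulo 𝒥ₙ

record Span {n} (S : Vec ℕ n → Set) (P : Poly n) : Set where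
  constructor span
  field
    {rep}  : Poly n
    rep-S  : AllExp S rep
    rep-~  : P ~ rep
open Span

module _ {n : ℕ} where

  span-mono : {S S′ : Vec ℕ n → Set} → (∀ {m} → S m → S′ m) → ∀ {P} → Span S P → Span S′ P
  span-mono f (span s e) = span (All.map f s) e

  span-≋ : {S : Vec ℕ n → Set} {P R : Poly n} → P ≋ R → Span S R → Span S P
  span-≋ h (span s e) = span s (~-trans (≋⇒~ h) e)

  span-self : {S : Vec ℕ n → Set} {P : Poly n} → AllExp S P → Span S P
  span-self s = span s ~-refl

  span-J : {S : Vec ℕ n → Set} {P : Poly n} → J P → Span S P
  span-J {P = P} h = span [] (~J (J-≋ (λ φ → sym (trans (ev-++ φ P []) (ℚₚ.+-identityʳ _))) h))

  span-⊕ : {S : Vec ℕ n → Set} {P R : Poly n} → Span S P → Span S R → Span S (P ⊕ R)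
  span-⊕ (span s e) (span s′ e′) = span (Allₚ.++⁺ s s′) (~-⊕ e e′)

  span-scale : {S : Vec ℕ n → Set} (c : ℚ) {P : Poly n} → Span S P → Span S (scale c P)
  span-scale c (span s e) = span (AllExp-scale c s) (~-scale c e)

  span-shift : {S S′ : Vec ℕ n → Set} (u : Vec ℕ n) → (∀ {m} → S m → S′ (u ⊞ m)) →
               ∀ {P} → Span S P → Span S′ (mapExp (u ⊞_) P)
  span-shift u f (span s e) = span (AllExp-map f s) (~-shift u e)

  span-terms : {S : Vec ℕ n → Set} {P : Poly n} → AllExp (Span S ∘ mono) P → Span S P
  span-terms []                      = span [] ~-refl
  span-terms {P = (c , m) ∷ P} (s ∷ ss) = span-≋ {R = scale c (mono m) ⊕ P}
    (λ φ → cong (λ x → x * φ m + ev φ P) (sym (ℚₚ.*-identityʳ c)))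
    (span-⊕ (span-scale c s) (span-terms ss))

  span-bind : {S S′ : Vec ℕ n → Set} → (∀ {m} → S m → Span S′ (mono m)) → ∀ {P} → Span S P → Span S′ P
  span-bind f (span s e) with span s′ e′ ← span-terms (All.map f s) = span s′ (~-trans e e′)

-- Exponents of the first n − r variables, the innermost being the last one.
data Prefix (n : ℕ) : ℕ → Set where
  ε   : Prefix n n
  _▸_ : ∀ {r} → Prefix n (suc r) → ℕ → Prefix n r

infixl 5 _▸_

module _ {n : ℕ} where

  plug : ∀ {r} → Prefix n r → Vec ℕ r → Vec ℕ n
  plug ε       m = m
  plug (w ▸ e) m = plug w (e ∷ m)

  -- `pad w u ⊞_` is multiplication by a monomial in the last r variables; of the prefix only the
  -- length matters.
  pad : ∀ {r} → Prefix n r → Vec ℕ r → Vec ℕ n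
  pad ε       m = m
  pad (w ▸ e) m = pad w (0 ∷ m)

  weightP : ∀ {r} → Prefix n r → ℕ
  weightP ε       = 0
  weightP (w ▸ e) = weightP w ℕ.+ e

  -- The first n − r exponents of μ are lexicographically smaller than the prefix.
  Lower : ∀ {r} → Prefix n r → Vec ℕ n → Set
  Lower ε       μ = ⊥
  Lower (w ▸ e) μ = Lower w μ ⊎ ∃[ e′ ] ∃[ m ] (e′ ℕ.< e × μ ≡ plug w (e′ ∷ m))

  pad-⊞-plug : ∀ {r} (w : Prefix n r) u m → pad w u ⊞ plug w m ≡ plug w (u ⊞ m)
  pad-⊞-plug ε       u m = refl
  pad-⊞-plug (w ▸ e) u m = pad-⊞-plug w (0 ∷ u) (e ∷ m)

  deg-plug : ∀ {r} (w : Prefix n r) m → deg (plug w m) ≡ weightP w ℕ.+ deg m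
  deg-plug ε       m = refl
  deg-plug (w ▸ e) m = trans (deg-plug w (e ∷ m)) (sym (ℕₚ.+-assoc (weightP w) e (deg m)))

  deg-pad : ∀ {r} (w : Prefix n r) m → deg (pad w m) ≡ deg m
  deg-pad ε       m = refl
  deg-pad (w ▸ e) m = deg-pad w (0 ∷ m)

  -- The comparison looks at the first n - r exponents, which such a factor leaves alone.
  Lower-pad : ∀ {r} (w : Prefix n r) u {μ} → Lower w μ → Lower w (pad w u ⊞ μ)
  Lower-pad (w ▸ e) u (inj₁ l)                  = inj₁ (Lower-pad w (0 ∷ u) l)
  Lower-pad (w ▸ e) u (inj₂ (e′ , m , lt , refl)) = inj₂ (e′ , u ⊞ m , lt , pad-⊞-plug w (0 ∷ u) (e′ ∷ m))

-- Some partial sum ℓ₁ + … + ℓᵢ with i ≥ 1 is at least c + i.  The truncation of suc c ∸ e is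
-- harmless: it only happens when c < e.
Cross : ℕ → List ℕ → Set
Cross c []      = ⊥
Cross c (e ∷ ℓ) = c ℕ.< e ⊎ Cross (suc c ∸ e) ℓ

Cross-anti : ∀ {c d} ℓ → c ℕ.≤ d → Cross d ℓ → Cross c ℓ
Cross-anti (e ∷ ℓ) le (inj₁ lt) = inj₁ (ℕₚ.≤-<-trans le lt)
Cross-anti (e ∷ ℓ) le (inj₂ cr) = inj₂ (Cross-anti ℓ (ℕₚ.∸-monoˡ-≤ e (s≤s le)) cr)

-- Without the 0 the same partial sums are reached one letter earlier.
Cross-drop0 : ∀ {c} ℓ → Cross c (0 ∷ ℓ) → Cross c ℓ
Cross-drop0 {c} ℓ (inj₂ cr) = Cross-anti ℓ (ℕₚ.n≤1+n c) cr

-- From the second letter on, partial sum and length both drop by one, so their difference is kept.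
Cross-merge : ∀ {c} a β → Cross c (0 ∷ suc a ∷ β) → Cross c (a ∷ β)
Cross-merge a β (inj₂ (inj₁ (s≤s lt))) = inj₁ lt
Cross-merge a β (inj₂ (inj₂ cr))       = inj₂ cr

module _ {n : ℕ} where

  CrossAt : ∀ {r} → Prefix n r → List ℕ → Set
  CrossAt ε       ℓ = Cross 0 ℓ
  CrossAt (w ▸ e) ℓ = CrossAt w (e ∷ ℓ)

  CrossAt-map : ∀ {r} (w : Prefix n r) {ℓ ℓ′} → (∀ {c} → Cross c ℓ → Cross c ℓ′) → CrossAt w ℓ → CrossAt w ℓ′
  CrossAt-map ε       f = f
  CrossAt-map (w ▸ e) f = CrossAt-map w λ { (inj₁ lt) → inj₁ lt ; (inj₂ cr) → inj₂ (f cr) }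

  Below : ∀ {r} → Prefix n r → ℕ → Vec ℕ n → Set
  Below w d μ = Lower w μ × deg μ ≡ weightP w ℕ.+ d

  private
    +0-assoc : ∀ w d → w ℕ.+ d ≡ w ℕ.+ 0 ℕ.+ d
    +0-assoc w d = cong (ℕ._+ d) (sym (ℕₚ.+-identityʳ w))

  incr-⊞ : ∀ {r} (m : Vec ℕ (suc r)) → incr m ≡ (1 ∷ zeros) ⊞ m
  incr-⊞ (e ∷ m) = cong (suc e ∷_) (sym (zeros-⊞ m))

  -- The recursion solved for its second summand, F_{(a+1)β}(x₂, ...) = F_{(a+1)β}(x₁, ...) - x₁
  -- F_{aβ}(x₁, ...), with x₁ the first variable after w, and multiplied by the monomial of w.
  plug-0∷-Q : ∀ {r} (w : Prefix n (suc r)) a β →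
    mapExp (plug (w ▸ 0)) (Q r (suc a ∷ β)) ≋
    (mapExp (plug w) (Q (suc r) (suc a ∷ β)) ⊕
     negP (mapExp (pad w (1 ∷ zeros) ⊞_) (mapExp (plug w) (Q (suc r) (a ∷ β)))))
  plug-0∷-Q {r} w a β φ = begin
    ev φ (mapExp (plug (w ▸ 0)) B)
      ≡⟨ trans (ev-mapExp φ _ B) (sym (ev-mapExp (φ ∘ plug w) (0 ∷_) B)) ⟩
    x
      ≡⟨ solve 2 (λ x y → x := (y :+ x) :- y) refl x y ⟩
    (y + x) - y
      ≡⟨ cong₂ _-_ (trans (sym (ev-++ (φ ∘ plug w) (mapExp incr A) _)) (sym (ev-mapExp φ (plug w) (Q (suc r) (suc a ∷ β)))))
           (trans (ev-mapExp (φ ∘ plug w) incr A) (trans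
             (ev-cong (λ m → cong φ (trans (cong (plug w) (incr-⊞ m)) (sym (pad-⊞-plug w (1 ∷ zeros) m)))) A)
             (trans (sym (ev-mapExp _ (plug w) A)) (sym (ev-mapExp φ (pad w (1 ∷ zeros) ⊞_) (mapExp (plug w) A)))))) ⟩
    ev φ (mapExp (plug w) (Q (suc r) (suc a ∷ β))) - ev φ (mapExp (pad w (1 ∷ zeros) ⊞_) (mapExp (plug w) A))
      ≡⟨ ev-⊖ φ (mapExp (plug w) (Q (suc r) (suc a ∷ β))) _ ⟨
    _ ∎
    where
    open ≡-Reasoning
    A = Q (suc r) (a ∷ β)
    B = Q r (suc a ∷ β)
    x = ev (φ ∘ plug w) (mapExp (0 ∷_) B)
    y = ev (φ ∘ plug w) (mapExp incr A)

  -- Both terms of `plug-0∷-Q` are reduced over the shorter prefix. The factor of the second is a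
  -- variable beyond w, so lower monomials stay lower.
  reduce-0∷ : ∀ {r} (w : Prefix n (suc r)) a β →
              Span (Below w (suc a ℕ.+ sum β)) (mapExp (plug w) (Q (suc r) (suc a ∷ β))) →
              Span (Below w (a ℕ.+ sum β)) (mapExp (plug w) (Q (suc r) (a ∷ β))) →
              Span (Below (w ▸ 0) (suc a ℕ.+ sum β)) (mapExp (plug (w ▸ 0)) (Q r (suc a ∷ β)))
  reduce-0∷ {r} w a β s s′ = span-≋ (plug-0∷-Q w a β)
    (span-⊕ (span-mono (λ (l , d) → inj₁ l , trans d (+0-assoc (weightP w) (suc a ℕ.+ sum β))) s)
            (span-scale (- 1ℚ) (span-shift (pad w (1 ∷ zeros)) raise s′)))
    where
    raise : ∀ {m} → Below w (a ℕ.+ sum β) m → Below (w ▸ zero) (suc a ℕ.+ sum β) (pad w (1 ∷ zeros) ⊞ m)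
    raise {m} (l , d) = inj₁ (Lower-pad w (1 ∷ zeros) l) ,
      trans (deg-⊞ (pad w (1 ∷ zeros)) m) (trans (cong₂ ℕ._+_ (trans (deg-pad w (1 ∷ zeros)) (cong suc (deg-zeros r))) d)
        (trans (sym (ℕₚ.+-suc (weightP w) (a ℕ.+ sum β))) (+0-assoc (weightP w) (suc a ℕ.+ sum β))))

  -- Induction on the prefix, then on α. A positive last exponent becomes a new first part of α by
  -- `Q-lead`, with errors that are smaller at that place. A last exponent 0 is removed by
  -- `reduce-0∷`, and the two resulting words still cross by `Cross-drop0` and `Cross-merge`.
  cross-reduce : ∀ {r} (w : Prefix n r) α → IsComposition α → CrossAt w α →
                 Span (Below w (sum α)) (mapExp (plug w) (Q r α))
  cross-reduce ε       (zero ∷ β)  (() ∷ _) cr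
  -- The empty word does not cross, so once the prefix is used up α is nonempty and F_α is a
  -- generator of 𝒥ₙ.
  cross-reduce ε       (suc a ∷ β) c cr =
    span-J (J-≋ (λ φ → trans (F≋Q n (suc a ∷ β) c φ) (sym (ev-mapExp φ id (Q n (suc a ∷ β)))))
           (J-F (suc a ∷ β) c (s≤s z≤n)))
  cross-reduce {r} (w ▸ suc e) α c cr with L , eq , low ← Q-lead r (suc e) α =
    span-≋ {R = mapExp (plug w) (Q (suc r) (suc e ∷ α)) ⊕ negP (mapExp (plug w) L)} lead
      (span-⊕ (span-mono (λ (l , d) → inj₁ l , trans d (sym (ℕₚ.+-assoc (weightP w) (suc e) (sum α))))
                (cross-reduce w (suc e ∷ α) (s≤s z≤n ∷ c) cr))
              (span-self (AllExp-scale (- 1ℚ) (AllExp-map (λ { {x ∷ m} (lt , d) → inj₂ (x , m , lt , refl) ,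
                 trans (deg-plug w (x ∷ m)) (trans (cong (weightP w ℕ.+_) d) (sym (ℕₚ.+-assoc (weightP w) (suc e) (sum α)))) }) low))))
    where
    lead : mapExp (plug (w ▸ suc e)) (Q r α) ≋ (mapExp (plug w) (Q (suc r) (suc e ∷ α)) ⊕ negP (mapExp (plug w) L))
    lead φ = trans (trans (ev-mapExp φ _ (Q r α)) (trans (sym (ev-mapExp (φ ∘ plug w) (suc e ∷_) (Q r α)))
      (solve 2 (λ x y → x := (x :+ y) :- y) refl _ (ev (φ ∘ plug w) L))))
      (sym (trans (ev-⊖ φ (mapExp (plug w) (Q (suc r) (suc e ∷ α))) _) (cong₂ _-_
        (trans (ev-mapExp φ (plug w) (Q (suc r) (suc e ∷ α))) (trans (eq _) (ev-++ _ (mapExp (suc e ∷_) (Q r α)) L)))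
        (ev-mapExp φ (plug w) L))))
  cross-reduce (w ▸ zero) []          c cr =
    span-mono (λ (l , d) → inj₁ l , trans d (+0-assoc (weightP w) 0))
      (cross-reduce w [] [] (CrossAt-map w (λ {c} → Cross-drop0 {c} []) cr))
  cross-reduce (w ▸ zero) (zero ∷ β)  (() ∷ _) cr
  cross-reduce (w ▸ zero) (suc zero ∷ β) (p ∷ c) cr = reduce-0∷ w 0 β
    (cross-reduce w (1 ∷ β) (p ∷ c) (CrossAt-map w (λ {c} → Cross-drop0 {c} (1 ∷ β)) cr))
    -- The leading part 0 says that the variable is absent. It is read as the exponent 0 of the
    -- prefix again, now with the shorter β.
    (span-≋ {R = mapExp (plug (w ▸ zero)) (Q _ β)}
      (λ φ → trans (ev-mapExp φ (plug w) (Q _ (0 ∷ β))) (trans (ev-mapExp _ (0 ∷_) (Q _ β)) (sym (ev-mapExp φ _ (Q _ β)))))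
      -- No exponent is below 0, so lower than `w ▸ zero` means lower than w.
      (span-mono (λ { (inj₁ l , d) → l , trans d (sym (+0-assoc (weightP w) (sum β))) })
        (cross-reduce (w ▸ zero) β c (CrossAt-map w (Cross-merge 0 β) cr))))
  cross-reduce (w ▸ zero) (suc (suc a) ∷ β) (p ∷ c) cr = reduce-0∷ w (suc a) β
    (cross-reduce w (suc (suc a) ∷ β) (p ∷ c) (CrossAt-map w (λ {c} → Cross-drop0 {c} (suc (suc a) ∷ β)) cr))
    (cross-reduce w (suc a ∷ β) (s≤s z≤n ∷ c) (CrossAt-map w (Cross-merge (suc a) β) cr))

-- Lexicographic descent to Dyck monomials

_<ₗ_ : ∀ {n} → Vec ℕ n → Vec ℕ n → Set
_<ₗ_ {zero}  m m′ = ⊥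
_<ₗ_ {suc n} m m′ = ×-Lex _≡_ ℕ._<_ _<ₗ_ (V.uncons m) (V.uncons m′)

<ₗ-wellFounded : ∀ n → WellFounded (_<ₗ_ {n})
<ₗ-wellFounded zero    m = acc λ ()
<ₗ-wellFounded (suc n) m = On.wellFounded V.uncons (×-wellFounded <-wellFounded (<ₗ-wellFounded n)) m

module _ {n : ℕ} where

  plug-mono : ∀ {r} (w : Prefix n r) {m m′} → m <ₗ m′ → plug w m <ₗ plug w m′
  plug-mono ε       lt = lt
  plug-mono (w ▸ e) lt = plug-mono w (inj₂ (refl , lt))

  Lower⇒<ₗ : ∀ {r} (w : Prefix n r) {μ} m → Lower w μ → μ <ₗ plug w m
  Lower⇒<ₗ (w ▸ e) m (inj₁ l)                      = Lower⇒<ₗ w (e ∷ m) l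
  Lower⇒<ₗ (w ▸ e) m (inj₂ (e′ , m′ , lt , refl)) = plug-mono w (inj₁ lt)

  prefix : ∀ {r} (w : Prefix n r) (m : Vec ℕ r) → CrossAt w (V.toList m) →
           ∃[ w′ ] (plug w m ≡ plug {r = 0} w′ [] × CrossAt w′ [])
  prefix w []      cr = w , refl , cr
  prefix w (e ∷ m) cr = prefix (w ▸ e) m cr

  -- The case k = n of `cross-reduce`: no variable is left and the quasi-symmetric factor is 1.
  mono-cross : ∀ (m : Vec ℕ n) → Cross 0 (V.toList m) → Span (λ μ → μ <ₗ m × deg μ ≡ deg m) (mono m)
  mono-cross m cr with w , refl , cr′ ← prefix ε m cr =
    span-mono (λ (l , d) → Lower⇒<ₗ w [] l , trans d (sym (deg-plug w []))) (cross-reduce w [] [] cr′)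

-- The exponent vectors below the diagonal, i.e. those with ε₁ + … + εᵢ ≤ c + i − 1 for all i.
dyck : ∀ n → ℕ → List (Vec ℕ n)
dyck zero    c       = [] ∷ []
dyck (suc n) zero    = L.map (0 ∷_) (dyck n 1)
dyck (suc n) (suc c) = L.map (0 ∷_) (dyck n (2 ℕ.+ c)) ++ L.map incr (dyck (suc n) c)

length-dyck : ∀ n c → L.length (dyck n c) ≡ ballot n c
length-dyck zero    c       = refl
length-dyck (suc n) zero    = trans (Lₚ.length-map _ (dyck n 1)) (length-dyck n 1)
length-dyck (suc n) (suc c) = trans (Lₚ.length-++ (L.map (0 ∷_) (dyck n (2 ℕ.+ c))))
  (cong₂ ℕ._+_ (trans (Lₚ.length-map _ (dyck n (2 ℕ.+ c))) (length-dyck n (2 ℕ.+ c)))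
               (trans (Lₚ.length-map _ (dyck (suc n) c)) (length-dyck (suc n) c)))

cross-or-dyck : ∀ n c (m : Vec ℕ n) → Cross c (V.toList m) ⊎ m ∈ dyck n c
cross-or-dyck zero    c       []          = inj₂ (here refl)
cross-or-dyck (suc n) zero    (zero ∷ m)  with cross-or-dyck n 1 m
... | inj₁ cr = inj₁ (inj₂ cr)
... | inj₂ d  = inj₂ (∈-map⁺ (0 ∷_) d)
cross-or-dyck (suc n) zero    (suc e ∷ m) = inj₁ (inj₁ (s≤s z≤n))
cross-or-dyck (suc n) (suc c) (zero ∷ m)  with cross-or-dyck n (2 ℕ.+ c) m
... | inj₁ cr = inj₁ (inj₂ cr)
... | inj₂ d  = inj₂ (∈-++⁺ˡ (∈-map⁺ (0 ∷_) d))
cross-or-dyck (suc n) (suc c) (suc e ∷ m) with cross-or-dyck (suc n) c (e ∷ m)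
... | inj₁ (inj₁ lt) = inj₁ (inj₁ (s≤s lt))
... | inj₁ (inj₂ cr) = inj₁ (inj₂ cr)
... | inj₂ d         = inj₂ (∈-++⁺ʳ (L.map (0 ∷_) (dyck n (2 ℕ.+ c))) (∈-map⁺ incr d))

-- The last of the inequalities that define `dyck (suc n) c`, namely i = n + 1.
dyck-deg : ∀ n c → All (λ m → deg m ℕ.≤ c ℕ.+ n) (dyck (suc n) c)
dyck-deg zero    zero    = z≤n ∷ []
dyck-deg (suc n) zero    = Allₚ.map⁺ (dyck-deg n 1)
dyck-deg zero    (suc c) = Allₚ.++⁺ (z≤n ∷ [])
  (Allₚ.map⁺ (All.map (λ { {e ∷ m} le → s≤s le }) (dyck-deg zero c)))
dyck-deg (suc n) (suc c) = Allₚ.++⁺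
  (Allₚ.map⁺ (All.map (λ le → ℕₚ.≤-trans le (ℕₚ.≤-reflexive (sym (cong suc (ℕₚ.+-suc c n))))) (dyck-deg n (2 ℕ.+ c))))
  (Allₚ.map⁺ (All.map (λ { {e ∷ m} le → s≤s le }) (dyck-deg (suc n) c)))

-- Replacing crossing monomials by smaller ones stops because the lexicographic order is
-- well-founded. The degree is recorded for `J-high-degree`.
dyck-spans : ∀ {n} (m : Vec ℕ n) → Span (λ μ → μ ∈ dyck n 0 × deg μ ≡ deg m) (mono m)
dyck-spans {n} m = go m (<ₗ-wellFounded n m)
  where
  go : ∀ m → Acc _<ₗ_ m → Span (λ μ → μ ∈ dyck n 0 × deg μ ≡ deg m) (mono m)
  go m (acc rs) with cross-or-dyck n 0 m
  ... | inj₂ d  = span-self ((d , refl) ∷ [])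
  ... | inj₁ cr = span-bind (λ {μ} (lt , d) → span-mono (λ (i , d′) → i , trans d′ d) (go μ (rs lt))) (mono-cross m cr)

-- Reduction preserves the degree, while vectors below the diagonal have degree at most n − 1.
J-high-degree : ∀ {n} (m : Vec ℕ (suc n)) → suc n ℕ.≤ deg m → J (mono m)
J-high-degree {n} m le with dyck-spans m
... | span []             e = J-~ e J-zero
... | span ((i , d) ∷ _) e =
  ⊥-elim (ℕₚ.<-irrefl refl (ℕₚ.≤-trans le (ℕₚ.≤-trans (ℕₚ.≤-reflexive (sym d)) (All.lookup (dyck-deg n 0) i))))

-- Elimination of relations

kron : ∀ {k} → Fin k → Fin k → ℚ
kron i j = if does (i ≟F j) then 1ℚ else 0ℚ

∑-kron : ∀ {k} (i : Fin k) (c : Fin k → ℚ) → ∑ (λ j → kron i j * c j) ≡ c i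
∑-kron {suc k} zero    c = trans (cong₂ _+_ (ℚₚ.*-identityˡ (c zero))
  (trans (sum-cong-≗ λ j → ℚₚ.*-zeroˡ (c (suc j))) (sum-replicate-zero k))) (ℚₚ.+-identityʳ (c zero))
∑-kron {suc k} (suc i) c = trans (cong₂ _+_ (ℚₚ.*-zeroˡ (c zero)) (∑-kron i (c ∘ suc))) (ℚₚ.+-identityˡ (c (suc i)))

fcomb : ∀ {n k} → (Fin k → Vec ℕ n) → (Fin k → ℚ) → Poly n
fcomb f v = L.tabulate (λ i → v i , f i)

module _ {n : ℕ} where

  ev-fcomb : ∀ {k} φ (f : Fin k → Vec ℕ n) v → ev φ (fcomb f v) ≡ ∑ (λ i → v i * φ (f i))
  ev-fcomb {zero}  φ f v = refl
  ev-fcomb {suc k} φ f v = cong (v zero * φ (f zero) +_) (ev-fcomb φ (f ∘ suc) (v ∘ suc))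

  fcomb-lin : ∀ {k} (f : Fin k → Vec ℕ n) a v b w →
              fcomb f (λ i → a * v i + b * w i) ≋ (scale a (fcomb f v) ⊕ scale b (fcomb f w))
  fcomb-lin f a v b w φ = trans (ev-fcomb φ f _) (trans (sum-cong-≗ λ i →
      solve 5 (λ a v b w x → (a :* v :+ b :* w) :* x := a :* (v :* x) :+ b :* (w :* x)) refl a (v i) b (w i) (φ (f i)))
    (trans (∑-distrib-+ (λ i → a * (v i * φ (f i))) _) (trans
      (sym (cong₂ _+_ (*-distribˡ-sum a (λ i → v i * φ (f i))) (*-distribˡ-sum b (λ i → w i * φ (f i)))))
      (sym (trans (ev-++ φ (scale a (fcomb f v)) _) (cong₂ _+_
        (trans (ev-scale φ a (fcomb f v)) (cong (a *_) (ev-fcomb φ f v)))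
        (trans (ev-scale φ b (fcomb f w)) (cong (b *_) (ev-fcomb φ f w)))))))))

  fcomb-kron : ∀ {k} (f : Fin k → Vec ℕ n) i → fcomb f (kron i) ≋ mono (f i)
  fcomb-kron f i φ = trans (ev-fcomb φ f (kron i)) (trans (∑-kron i (φ ∘ f)) (sym (ev-mono φ (f i))))

  fcomb-zero : ∀ {k} (f : Fin k → Vec ℕ n) → fcomb f (λ _ → 0ℚ) ≋ []
  fcomb-zero {k} f φ = trans (ev-fcomb φ f _) (trans (sum-cong-≗ λ i → ℚₚ.*-zeroˡ (φ (f i))) (sum-replicate-zero k))

  ~-J : ∀ {P R S : Poly n} → J R → P ~ (S ⊕ R) → P ~ S
  ~-J {P} {R} {S} (inJ r) h = ~-trans h (~-trans
    (~-⊕ {P = S} {R = S} {P′ = R} {R′ = []} ~-refl (~J (J-≋ {P = R} (λ φ → sym (trans (ev-++ φ R []) (ℚₚ.+-identityʳ _))) (inJ r))))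
    (≋⇒~ λ φ → trans (ev-++ φ S []) (ℚₚ.+-identityʳ _)))

-- A reduction of all monomials to k of them modulo 𝒥ₙ; the x^{f i} need not be independent.
record Reduction (n k : ℕ) : Set where
  field
    f      : Fin k → Vec ℕ n
    π      : Vec ℕ n → Fin k → ℚ
    π-~    : ∀ m → mono m ~ fcomb f (π m)
    π-high : ∀ m → n ℕ.≤ deg m → ∀ i → π m i ≡ 0ℚ

  π* : Poly n → Fin k → ℚ
  π* P i = ev (λ m → π m i) P

  π*-~ : ∀ P → P ~ fcomb f (π* P)
  π*-~ []            = ≋⇒~ λ φ → sym (fcomb-zero f φ)
  π*-~ ((c , m) ∷ P) = ~-trans (≋⇒~ {R = scale c (mono m) ⊕ scale 1ℚ P} λ φ →
      trans (solve 3 (λ c x y → c :* x :+ y := c :* x :+ con 1ℚ :* y) refl c (φ m) (ev φ P))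
        (sym (trans (ev-++ φ (scale c (mono m)) (scale 1ℚ P))
          (cong₂ _+_ (trans (ev-scale φ c (mono m)) (cong (c *_) (ev-mono φ m))) (ev-scale φ 1ℚ P)))))
    (~-trans (~-⊕ {P = scale c (mono m)} {P′ = scale 1ℚ P} (~-scale c (π-~ m)) (~-scale 1ℚ {P} (π*-~ P)))
      (≋⇒~ λ φ → trans (sym (fcomb-lin f c (π m) 1ℚ (π* P) φ)) (trans (ev-fcomb φ f _)
        (trans (sum-cong-≗ λ i → cong (λ x → (c * π m i + x) * φ (f i)) (ℚₚ.*-identityˡ (π* P i))) (sym (ev-fcomb φ f _))))))

open Reduction

-- Monomials of degree at least the number of variables lie in 𝒥ₙ and are sent to 0 outright. This
-- leaves π with finite support.
initial : ∀ n → Reduction (suc n) (L.length (dyck (suc n) 0))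
initial n = record
  { f      = g
  ; π      = λ m → proj₁ (choose m)
  ; π-~    = λ m → proj₁ (proj₂ (choose m))
  ; π-high = λ m → proj₂ (proj₂ (choose m))
  }
  where
  B = dyck (suc n) 0
  g : Fin (L.length B) → Vec ℕ (suc n)
  g = L.lookup B
  combine : ∀ P → AllExp (_∈ B) P → ∃[ v ] P ~ fcomb g v
  combine []            []       = (λ _ → 0ℚ) , ≋⇒~ λ φ → sym (fcomb-zero g φ)
  combine ((c , m) ∷ P) (i ∷ is) with v , h ← combine P is =
    (λ j → c * kron (Any.index i) j + 1ℚ * v j) , ~-trans
      (≋⇒~ {R = scale c (fcomb g (kron (Any.index i))) ⊕ scale 1ℚ P} λ φ →
        trans (cong₂ _+_ (cong (c *_) (trans (trans (cong φ (lookup-index i)) (sym (ev-mono φ _))) (sym (fcomb-kron g (Any.index i) φ))))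
                         (sym (ℚₚ.*-identityˡ (ev φ P))))
          (sym (trans (ev-++ φ (scale c (fcomb g (kron (Any.index i)))) _)
            (cong₂ _+_ (ev-scale φ c (fcomb g (kron (Any.index i)))) (ev-scale φ 1ℚ P)))))
      (~-trans (~-⊕ {P = scale c (fcomb g (kron (Any.index i)))} ~-refl (~-scale 1ℚ h))
        (≋⇒~ λ φ → sym (fcomb-lin g c (kron (Any.index i)) 1ℚ v φ)))
  choose : ∀ m → ∃[ v ] (mono m ~ fcomb g v × (suc n ℕ.≤ deg m → ∀ i → v i ≡ 0ℚ))
  choose m with suc n ℕ.≤? deg m
  ... | yes le = (λ _ → 0ℚ) , ~-J (J-high-degree m le) (≋⇒~ λ φ →
                   sym (trans (ev-++ φ (fcomb g _) (mono m)) (trans (cong (_+ ev φ (mono m)) (fcomb-zero g φ)) (ℚₚ.+-identityˡ _)))) ,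
                 λ _ _ → refl
  ... | no  ≰  with span {P} s h ← dyck-spans m with v , h′ ← combine P (All.map proj₁ s) =
                 v , ~-trans h h′ , λ le → ⊥-elim (≰ le)

Relation : ∀ {n k} → Reduction n k → (Fin k → ℚ) → Set
Relation R v = J (fcomb (f R) v)

-- Since v i ≠ 0 the relation can be solved for x^{f i}; subtracting π m i / v i times the relation
-- cancels the i-th coordinate of every monomial.
eliminate : ∀ {n k} (R : Reduction n (suc k)) v → Relation R v → ∀ i → v i ≢ 0ℚ → Reduction n k
eliminate {n} {k} R v rel i v≢0 = record
  { f      = f R ∘ punchIn i
  ; π      = π′
  ; π-~    = λ m → ~-J (J-scale (π R m i * t) rel) (~-trans (π-~ R m) (≋⇒~ (split m)))
  ; π-high = λ m le j → trans (cong₂ (λ x y → x - v (punchIn i j) * t * y) (π-high R m le (punchIn i j)) (π-high R m le i))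
      (solve 2 (λ a b → con 0ℚ :- a :* b :* con 0ℚ := con 0ℚ) refl (v (punchIn i j)) t)
  }
  where
  t : ℚ
  t = 1/_ (v i) {{≢-nonZero v≢0}}
  t*v≡1 : t * v i ≡ 1ℚ
  t*v≡1 = ℚₚ.*-inverseˡ (v i) {{≢-nonZero v≢0}}
  π′ : Vec ℕ n → Fin k → ℚ
  π′ m j = π R m (punchIn i j) - v (punchIn i j) * t * π R m i
  split : ∀ m → fcomb (f R) (π R m) ≋ (fcomb (f R ∘ punchIn i) (π′ m) ⊕ scale (π R m i * t) (fcomb (f R) v))
  split m φ = begin
    ev φ (fcomb (f R) (π R m))
      ≡⟨ trans (ev-fcomb φ (f R) (π R m)) (sum-remove {i = i} (λ j → π R m j * x j)) ⟩
    p * x i + ∑ (λ j → π R m (punchIn i j) * y j)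
      ≡⟨ cong (p * x i +_) (trans (sum-cong-≗ λ j →
           solve 5 (λ π v t p y → π :* y := (π :- v :* t :* p) :* y :+ (p :* t) :* (v :* y)) refl
             (π R m (punchIn i j)) (v (punchIn i j)) t p (y j))
           (trans (∑-distrib-+ (λ j → π′ m j * y j) _)
             (cong (∑ (λ j → π′ m j * y j) +_) (sym (*-distribˡ-sum (p * t) (λ j → v (punchIn i j) * y j)))))) ⟩
    p * x i + (A + p * t * B)
      ≡⟨ cong (λ u → p * u + (A + p * t * B)) (trans (sym (ℚₚ.*-identityˡ (x i))) (cong (_* x i) (sym t*v≡1))) ⟩
    p * (t * v i * x i) + (A + p * t * B)
      ≡⟨ solve 6 (λ p t v x a b → p :* (t :* v :* x) :+ (a :+ p :* t :* b) := a :+ p :* t :* (v :* x :+ b)) refl p t (v i) (x i) A B ⟩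
    A + p * t * (v i * x i + B)
      ≡⟨ cong₂ _+_ (sym (ev-fcomb φ (f R ∘ punchIn i) (π′ m)))
           (trans (cong (p * t *_) (sym (trans (ev-fcomb φ (f R) v) (sum-remove {i = i} (λ j → v j * x j)))))
             (sym (ev-scale φ (p * t) (fcomb (f R) v)))) ⟩
    ev φ (fcomb (f R ∘ punchIn i) (π′ m)) + ev φ (scale (p * t) (fcomb (f R) v))
      ≡⟨ ev-++ φ (fcomb (f R ∘ punchIn i) (π′ m)) _ ⟨
    _ ∎
    where
    open ≡-Reasoning
    p = π R m i
    x : Fin (suc k) → ℚ
    x j = φ (f R j)
    y : Fin k → ℚ
    y j = φ (f R (punchIn i j))
    A = ∑ (λ j → π′ m j * y j)
    B = ∑ (λ j → v (punchIn i j) * y j)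

-- Finitely many test relations

vecs : ∀ n → ℕ → List (Vec ℕ n)
vecs n       zero    = []
vecs zero    (suc d) = [] ∷ []
vecs (suc n) (suc d) = L.map (0 ∷_) (vecs n (suc d)) ++ L.map incr (vecs (suc n) d)

∈-vecs : ∀ {n} d (m : Vec ℕ n) → deg m ℕ.< d → m ∈ vecs n d
∈-vecs (suc d) []          lt       = here refl
∈-vecs (suc d) (zero ∷ m)  lt       = ∈-++⁺ˡ (∈-map⁺ (0 ∷_) (∈-vecs (suc d) m lt))
∈-vecs (suc d) (suc e ∷ m) (s≤s lt) = ∈-++⁺ʳ _ (∈-map⁺ incr (∈-vecs d (e ∷ m) lt))

bump : List ℕ → List ℕ
bump []      = []
bump (a ∷ α) = suc a ∷ α

-- Includes all compositions of size at most d: a nonempty one arises from a smaller one by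
-- prepending 1 or by increasing its first part.
comps : ℕ → List (List ℕ)
comps zero    = [] ∷ []
comps (suc d) = [] ∷ L.map (1 ∷_) (comps d) ++ L.map bump (comps d)

∈-comps : ∀ d α → IsComposition α → sum α ℕ.≤ d → α ∈ comps d
∈-comps zero    []                _       _        = here refl
∈-comps zero    (zero ∷ α)        (() ∷ _)
∈-comps zero    (suc a ∷ α)       _       ()
∈-comps (suc d) []                _       _        = here refl
∈-comps (suc d) (suc zero ∷ α)    (_ ∷ c) (s≤s le) = there (∈-++⁺ˡ (∈-map⁺ (1 ∷_) (∈-comps d α c le)))
∈-comps (suc d) (suc (suc a) ∷ α) (_ ∷ c) (s≤s le) =
  there (∈-++⁺ʳ _ (∈-map⁺ bump (∈-comps d (suc a ∷ α) (s≤s z≤n ∷ c) le)))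

nonConst? : ∀ α → Dec (IsComposition α × 0 ℕ.< sum α)
nonConst? α = All.all? (0 ℕ.<?_) α ×-dec (0 ℕ.<? sum α)

-- The default `[]` also lies in 𝒥ₙ, so a list of candidates need not consist of proper
-- compositions.
generator : ∀ {n} → Vec ℕ n × List ℕ → Poly n
generator {n} (m , α) with nonConst? α
... | yes _ = mapExp (m ⊞_) (F n α)
... | no  _ = []

J-generator : ∀ {n} (g : Vec ℕ n × List ℕ) → J (generator g)
J-generator (m , α) with nonConst? α
... | yes (c , p) = J-shift m (J-F α c p)
... | no  _       = J-zero

-- Enough to test whether π vanishes on 𝒥ₙ: multiples x^m F_α of degree at least n are killed by
-- `π-high`.
generators : ∀ n → List (Vec ℕ n × List ℕ)
generators n = L.cartesianProduct (vecs n n) (comps n)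

-- x^{f i} is a basis of Rₙ and π is the dual family of functionals.
record DualPair (n k : ℕ) : Set where
  field
    reduction : Reduction n k
    π-f       : ∀ i j → π reduction (f reduction i) j ≡ kron i j
    π-J       : ∀ {P} → J P → ∀ i → π* reduction P i ≡ 0ℚ

module _ {n k : ℕ} (R : Reduction n k) where

  first-nonzero : ∀ {A : Set} (r : A → Fin k → ℚ) (xs : List A) →
                  All (λ x → ∀ i → r x i ≡ 0ℚ) xs ⊎ ∃[ x ] ∃[ i ] r x i ≢ 0ℚ
  first-nonzero r []       = inj₁ []
  first-nonzero r (x ∷ xs) with all? (λ i → r x i ℚₚ.≟ 0ℚ)
  ... | no ¬z = inj₂ (x , ¬∀⟶∃¬ k _ (λ i → r x i ℚₚ.≟ 0ℚ) ¬z)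
  ... | yes z with first-nonzero r xs
  ...   | inj₁ zs = inj₁ (z ∷ zs)
  ...   | inj₂ nz = inj₂ nz

  relation-generator : ∀ g → Relation R (π* R (generator g))
  relation-generator g = J-~ (~-sym (π*-~ R (generator g))) (J-generator g)

  -- The coordinates of x^{f i} minus its own reduction, which is a relation; it is trivial when π
  -- fixes x^{f i}. The coefficients 1 and -1 match `fcomb-lin`.
  deviation : Fin k → Fin k → ℚ
  deviation i j = 1ℚ * kron i j + (- 1ℚ) * π R (f R i) j

  relation-deviation : ∀ i → Relation R (deviation i)
  relation-deviation i = J-≋ (λ φ → trans
      (trans (ev-++ φ (mono (f R i)) (negP (fcomb (f R) (π R (f R i))))) (cong (_+ ev φ (negP (fcomb (f R) (π R (f R i)))))
        (sym (trans (ev-scale φ 1ℚ (fcomb (f R) (kron i))) (trans (ℚₚ.*-identityˡ _) (fcomb-kron (f R) i φ))))))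
      (trans (sym (ev-++ φ (scale 1ℚ (fcomb (f R) (kron i))) (negP (fcomb (f R) (π R (f R i))))))
             (sym (fcomb-lin (f R) 1ℚ (kron i) (- 1ℚ) (π R (f R i)) φ))))
    (J-⊖ (π-~ R (f R i)))

  -- Vanishing deviations are the duality `π-f`. For `π-J`, an element of 𝒥ₙ is a combination of
  -- products x^m F_α, each of which is either in the tested list or of degree at least n.
  dual : (∀ i j → deviation i j ≡ 0ℚ) → All (λ g → ∀ i → π* R (generator g) i ≡ 0ℚ) (generators n) → DualPair n k
  dual dev gen = record { reduction = R ; π-f = π-f′ ; π-J = π-J′ }
    where
    π-f′ : ∀ i j → π R (f R i) j ≡ kron i j
    π-f′ i j = sym (-≡0⇒≡ (trans
      (solve 2 (λ x y → x :- y := con 1ℚ :* x :+ con (- 1ℚ) :* y) refl (kron i j) (π R (f R i) j)) (dev i j)))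
    module _ (i : Fin k) where
      kill : ∀ m α → IsComposition α → 0 ℕ.< sum α → ev (λ m′ → π R (m ⊞ m′) i) (F n α) ≡ 0ℚ
      kill m α c p with deg m ℕ.+ sum α ℕ.<? n
      ... | yes lt = trans (sym (ev-mapExp (λ m → π R m i) (m ⊞_) (F n α))) (trans same (All.lookup gen
              (∈-cartesianProduct⁺ (∈-vecs n m (ℕₚ.≤-<-trans (ℕₚ.m≤m+n (deg m) (sum α)) lt))
                                   (∈-comps n α c (ℕₚ.<⇒≤ (ℕₚ.≤-<-trans (ℕₚ.m≤n+m (sum α) (deg m)) lt)))) i))
        where
        same : ev (λ m → π R m i) (mapExp (m ⊞_) (F n α)) ≡ π* R (generator (m , α)) i
        same with nonConst? α
        ... | yes _ = refl
        ... | no ¬p = ⊥-elim (¬p (c , p))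
      -- F_α is homogeneous, so every term of x^m F_α has degree deg m + sum α ≥ n.
      ... | no ≮ = trans (F≋Q n α c _) (trans
              (ev-cong-All (λ m′ e → π-high R (m ⊞ m′) (ℕₚ.≤-trans (ℕₚ.≮⇒≥ ≮)
                 (ℕₚ.≤-reflexive (sym (trans (deg-⊞ m m′) (cong (deg m ℕ.+_) e))))) i) (Q n α) (Q-deg n α))
              (ev-zero (Q n α)))
      kill-combo : ∀ gs → π* R (combo gs) i ≡ 0ℚ
      kill-combo []                     = refl
      kill-combo ((g , α , c , p) ∷ gs) = trans (ev-++ _ (g ⊗ F n α) (combo gs)) (cong₂ _+_
        (trans (ev-⊗ _ g (F n α)) (trans (ev-cong (λ m → kill m α c p) g) (ev-zero g))) (kill-combo gs))
    π-J′ : ∀ {P} → J P → ∀ i → π* R P i ≡ 0ℚ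
    π-J′ {P} (inJ (gs , e)) i = trans (≈⇒≋ {P = P} {combo gs} e _) (kill-combo i gs)

dual-or-relation : ∀ {n k} (R : Reduction n k) →
                   DualPair n k ⊎ ∃[ v ] (Relation R v × ∃[ i ] v i ≢ 0ℚ)
dual-or-relation {n} {k} R = [ generators-vanish , (λ (x , i , nz) → inj₂ (deviation R x , relation-deviation R x , i , nz)) ]′
                               (first-nonzero R (deviation R) (L.allFin k))
  where
  generators-vanish : All (λ x → ∀ i → deviation R x i ≡ 0ℚ) (L.allFin k) →
                      DualPair n k ⊎ ∃[ v ] (Relation R v × ∃[ i ] v i ≢ 0ℚ)
  generators-vanish dev =
    [ (λ gen → inj₁ (dual R (Allₚ.tabulate⁻ dev) gen))
    , (λ (g , i , nz) → inj₂ (π* R (generator g) , relation-generator R g , i , nz)) ]′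
    (first-nonzero R (λ g → π* R (generator g)) (generators n))

-- Each nontrivial relation found costs one monomial, so the search ends, and the number of
-- monomials never grows.
minimise : ∀ {n} k → Reduction n k → ∃[ k′ ] (k′ ℕ.≤ k × DualPair n k′)
minimise-by : ∀ {n} k (R : Reduction n k) → DualPair n k ⊎ ∃[ v ] (Relation R v × ∃[ i ] v i ≢ 0ℚ) →
              ∃[ k′ ] (k′ ℕ.≤ k × DualPair n k′)
minimise k R = minimise-by k R (dual-or-relation R)
minimise-by k       R (inj₁ D)                  = k , ℕₚ.≤-refl , D
minimise-by (suc k) R (inj₂ (v , rel , i , nz)) =
  map₂ (λ (le , D) → ℕₚ.m≤n⇒m≤1+n le , D) (minimise k (eliminate R v rel i nz))

abstract
  dual-pair : ∀ n → ∃[ k ] (k ℕ.≤ L.length (dyck (suc n) 0) × DualPair (suc n) k)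
  dual-pair n = minimise _ (initial n)

-- Differential operators and the two bases

δ-mapExp : ∀ {n k} (h : Vec ℕ n → Vec ℕ k) → (∀ {m m′} → h m ≡ h m′ → m ≡ m′) →
           ∀ m m′ → δ (h m) (h m′) ≡ δ m m′
δ-mapExp h inj m m′ with Vₚ.≡-dec ℕ._≟_ (h m′) (h m) | Vₚ.≡-dec ℕ._≟_ m′ m
... | yes _ | yes _    = refl
... | no _  | no _     = refl
... | yes e | no ¬e    = ⊥-elim (¬e (inj e))
... | no ¬e | yes refl = ⊥-elim (¬e refl)

coeff-mapExp : ∀ {n k} (h : Vec ℕ n → Vec ℕ k) → (∀ {m m′} → h m ≡ h m′ → m ≡ m′) →
               ∀ P m → coeff (mapExp h P) (h m) ≡ coeff P m
coeff-mapExp h inj P m = trans (coeff-ev (mapExp h P) (h m)) (trans (ev-mapExp (δ (h m)) h P)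
  (trans (ev-cong (δ-mapExp h inj m) P) (sym (coeff-ev P m))))

coeff-mapExp-∉ : ∀ {n k} (h : Vec ℕ n → Vec ℕ k) m → (∀ m′ → h m′ ≢ m) → ∀ P → coeff (mapExp h P) m ≡ 0ℚ
coeff-mapExp-∉ h m ∉ []             = refl
coeff-mapExp-∉ h m ∉ ((c , m′) ∷ P) with Vₚ.≡-dec ℕ._≟_ (h m′) m
... | yes e = ⊥-elim (∉ m′ e)
... | no _  = coeff-mapExp-∉ h m ∉ P

coeff-++ : ∀ {n} (P R : Poly n) m → coeff (P ⊕ R) m ≡ coeff P m + coeff R m
coeff-++ P R m = trans (coeff-ev (P ⊕ R) m) (trans (ev-++ (δ m) P R) (sym (cong₂ _+_ (coeff-ev P m) (coeff-ev R m))))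

abstract
  -- The terms without x₁ and those divisible by x₁ are built separately; dividing the latter by x₁
  -- lowers the degree bound.
  fromCoeff : ∀ n d (g : Vec ℕ n → ℚ) → (∀ m → d ≤ deg m → g m ≡ 0ℚ) → ∃[ P ] (∀ m → coeff P m ≡ g m)
  fromCoeff n       zero    g z = [] , λ m → sym (z m z≤n)
  fromCoeff zero    (suc d) g z = (g [] , []) ∷ [] , λ { [] → ℚₚ.+-identityʳ (g []) }
  fromCoeff (suc n) (suc d) g z
    with P , p ← fromCoeff n (suc d) (g ∘ (0 ∷_)) (λ m le → z (0 ∷ m) le)
       | R , r ← fromCoeff (suc n) d (g ∘ incr) (λ m le → z (incr m) (ℕₚ.≤-trans (s≤s le) (ℕₚ.≤-reflexive (sym (deg-incr m))))) =
    mapExp (0 ∷_) P ⊕ mapExp incr R , λ m → trans (coeff-++ (mapExp (0 ∷_) P) (mapExp incr R) m) (at m)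
    where
    incr-inj : ∀ {k} {m m′ : Vec ℕ (suc k)} → incr m ≡ incr m′ → m ≡ m′
    incr-inj {m = x ∷ m} {y ∷ m′} refl = refl
    at : ∀ m → coeff (mapExp (0 ∷_) P) m + coeff (mapExp incr R) m ≡ g m
    at (zero ∷ m)  = trans (cong₂ _+_ (trans (coeff-mapExp (0 ∷_) Vₚ.∷-injectiveʳ P m) (p m))
      (coeff-mapExp-∉ incr (zero ∷ m) (λ { (x ∷ m′) () }) R)) (ℚₚ.+-identityʳ _)
    at (suc e ∷ m) = trans (cong₂ _+_ (coeff-mapExp-∉ (0 ∷_) (suc e ∷ m) (λ _ ()) P)
      (trans (coeff-mapExp incr incr-inj R (e ∷ m)) (r (e ∷ m)))) (ℚₚ.+-identityˡ _)

-- The effect of iterated partial derivatives on coefficients. The notion is closed under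
-- composition and records only that the factors are nonzero, which spares computing factorials.
record Rescaling {n} (T : Poly n → Poly n) (g : Vec ℕ n → Vec ℕ n) : Set where
  field
    factor   : Vec ℕ n → ℚ
    factor≢0 : ∀ m → factor m ≢ 0ℚ
    coeff-T  : ∀ P m → coeff (T P) m ≡ factor m * coeff P (g m)
open Rescaling

*≢0 : ∀ {x y : ℚ} → x ≢ 0ℚ → y ≢ 0ℚ → x * y ≢ 0ℚ
*≢0 {x} {y} x≢0 y≢0 xy≡0 = y≢0 (begin
  y              ≡⟨ ℚₚ.*-identityˡ y ⟨
  1ℚ * y         ≡⟨ cong (_* y) (ℚₚ.*-inverseˡ x {{≢-nonZero x≢0}}) ⟨
  x⁻¹ * x * y    ≡⟨ ℚₚ.*-assoc x⁻¹ x y ⟩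
  x⁻¹ * (x * y)  ≡⟨ cong (x⁻¹ *_) xy≡0 ⟩
  x⁻¹ * 0ℚ       ≡⟨ ℚₚ.*-zeroʳ x⁻¹ ⟩
  0ℚ             ∎)
  where
  open ≡-Reasoning
  x⁻¹ = 1/_ x {{≢-nonZero x≢0}}

ℕtoℚ-suc≢0 : ∀ k → ℕtoℚ (suc k) ≢ 0ℚ
ℕtoℚ-suc≢0 k e with () ← subst Positive e (ℚₚ.normalize-pos (suc k) 1)

module _ {n : ℕ} where

  rescaling-id : Rescaling {n} id id
  rescaling-id = record { factor = λ _ → 1ℚ ; factor≢0 = λ _ () ; coeff-T = λ P m → sym (ℚₚ.*-identityˡ (coeff P m)) }

  rescaling-∘ : ∀ {T U : Poly n → Poly n} {g h} → Rescaling T g → Rescaling U h → Rescaling (T ∘ U) (h ∘ g)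
  rescaling-∘ {U = U} {g} {h} t u = record
    { factor   = λ m → factor t m * factor u (g m)
    ; factor≢0 = λ m → *≢0 (factor≢0 t m) (factor≢0 u (g m))
    ; coeff-T  = λ P m → trans (coeff-T t (U P) m) (trans (cong (factor t m *_) (coeff-T u P (g m)))
                   (sym (ℚₚ.*-assoc (factor t m) (factor u (g m)) (coeff P (h (g m))))))
    }

  raise : Fin n → Vec ℕ n → Vec ℕ n
  raise i m = V.updateAt m i suc

  lower : Fin n → Vec ℕ n → Vec ℕ n
  lower i m = V.updateAt m i ℕ.pred

  lower-raise : ∀ i m → lower i (raise i m) ≡ m
  lower-raise i m = trans (Vₚ.updateAt-updateAt-local i {ℕ.pred} {suc} {id} m refl) (Vₚ.updateAt-id i m)

  raise-lower : ∀ i m {k} → V.lookup m i ≡ suc k → raise i (lower i m) ≡ m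
  raise-lower i m e = trans (Vₚ.updateAt-updateAt i {suc} {ℕ.pred} m)
    (Vₚ.updateAt-id-local i m (trans (cong (λ x → suc (ℕ.pred x)) e) (sym e)))

  ev-deriv : ∀ i φ (P : Poly n) → ev φ (deriv i P) ≡ ev (λ m → ℕtoℚ (V.lookup m i) * φ (lower i m)) P
  ev-deriv i φ []            = refl
  ev-deriv i φ ((c , m) ∷ P) = cong₂ _+_ (ℚₚ.*-assoc c (ℕtoℚ (V.lookup m i)) (φ (lower i m))) (ev-deriv i φ P)

  rescaling-deriv : ∀ i → Rescaling (deriv i) (raise i)
  rescaling-deriv i = record
    { factor   = λ m → ℕtoℚ (suc (V.lookup m i))
    ; factor≢0 = λ m → ℕtoℚ-suc≢0 (V.lookup m i)
    ; coeff-T  = λ P m → trans (coeff-ev (deriv i P) m) (trans (ev-deriv i (δ m) P) (trans (ev-cong (at m) P)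
                   (trans (ev-*ˡ (ℕtoℚ (suc (V.lookup m i))) (δ (raise i m)) P)
                   (cong (ℕtoℚ (suc (V.lookup m i)) *_) (sym (coeff-ev P (raise i m)))))))
    }
    where
    at : ∀ m m′ → ℕtoℚ (V.lookup m′ i) * δ m (lower i m′) ≡ ℕtoℚ (suc (V.lookup m i)) * δ (raise i m) m′
    at m m′ with Vₚ.≡-dec ℕ._≟_ m′ (raise i m) | Vₚ.≡-dec ℕ._≟_ (lower i m′) m
    ... | yes refl | yes _    = cong (λ x → ℕtoℚ x * 1ℚ) (Vₚ.lookup∘updateAt i m)
    ... | yes refl | no ¬e    = ⊥-elim (¬e (lower-raise i m))
    ... | no _     | no _     = trans (ℚₚ.*-zeroʳ (ℕtoℚ (V.lookup m′ i))) (sym (ℚₚ.*-zeroʳ (ℕtoℚ (suc (V.lookup m i)))))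
    ... | no ¬e    | yes refl = go (V.lookup m′ i) refl
      where
      go : ∀ k → V.lookup m′ i ≡ k → ℕtoℚ (V.lookup m′ i) * 1ℚ ≡ ℕtoℚ (suc (V.lookup (lower i m′) i)) * 0ℚ
      -- Here `pred` truncates, but differentiation contributes the factor 0.
      go zero    eq = trans (cong (λ x → ℕtoℚ x * 1ℚ) eq) (sym (ℚₚ.*-zeroʳ (ℕtoℚ (suc (V.lookup (lower i m′) i)))))
      go (suc k) eq = ⊥-elim (¬e (sym (raise-lower i m′ eq)))

  raises : Fin n → ℕ → Vec ℕ n → Vec ℕ n
  raises i zero    m = m
  raises i (suc k) m = raises i k (raise i m)

  rescaling-derivPow : ∀ i k → Rescaling (derivPow i k) (raises i k)
  rescaling-derivPow i zero    = rescaling-id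
  rescaling-derivPow i (suc k) = rescaling-∘ (rescaling-deriv i) (rescaling-derivPow i k)

  raiseAll : Vec ℕ n → List (Fin n) → Vec ℕ n → Vec ℕ n
  raiseAll m []       = id
  raiseAll m (i ∷ is) = raiseAll m is ∘ raises i (V.lookup m i)

  rescaling-derivs : ∀ m → Rescaling (derivs m) (raiseAll m (L.allFin n))
  rescaling-derivs m = go (L.allFin n)
    where
    go : ∀ is → Rescaling (λ R → L.foldr (λ i acc → derivPow i (V.lookup m i) acc) R is) (raiseAll m is)
    go []       = rescaling-id
    go (i ∷ is) = rescaling-∘ (rescaling-derivPow i (V.lookup m i)) (go is)

raises-zero : ∀ {n} k e (m : Vec ℕ n) → raises zero k (e ∷ m) ≡ k ℕ.+ e ∷ m
raises-zero zero    e m = refl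
raises-zero (suc k) e m = trans (raises-zero k (suc e) m) (cong (_∷ m) (ℕₚ.+-suc k e))

raises-suc : ∀ {n} (i : Fin n) k e m → raises (suc i) k (e ∷ m) ≡ e ∷ raises i k m
raises-suc i zero    e m = refl
raises-suc i (suc k) e m = raises-suc i k e (raise i m)

raiseAll-suc : ∀ {n} x (m : Vec ℕ n) is e m′ → raiseAll (x ∷ m) (L.map suc is) (e ∷ m′) ≡ e ∷ raiseAll m is m′
raiseAll-suc x m []       e m′ = refl
raiseAll-suc x m (i ∷ is) e m′ = trans (cong (raiseAll (x ∷ m) (L.map suc is)) (raises-suc i (V.lookup m i) e m′))
  (raiseAll-suc x m is e (raises i (V.lookup m i) m′))

-- This identifies the coefficient of R that survives as the constant term of its derivative by m:
-- the one at m itself.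
raiseAll-zeros : ∀ {n} (m : Vec ℕ n) → raiseAll m (L.allFin n) zeros ≡ m
raiseAll-zeros []      = refl
raiseAll-zeros (x ∷ m) = trans (cong (raiseAll (x ∷ m) (L.tabulate suc)) (raises-zero x 0 zeros))
  (trans (cong (λ is → raiseAll (x ∷ m) is (x ℕ.+ 0 ∷ zeros)) (sym (Lₚ.map-tabulate id suc)))
  (trans (raiseAll-suc x m (L.allFin _) (x ℕ.+ 0) zeros) (cong₂ _∷_ (ℕₚ.+-identityʳ x) (raiseAll-zeros m))))

module _ {n : ℕ} where

  abstract
    -- κ m = m₁! ⋯ mₙ!, of which only the nonvanishing matters.
    κ : Vec ℕ n → ℚ
    κ m = factor (rescaling-derivs m) zeros

    κ≢0 : ∀ m → κ m ≢ 0ℚ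
    κ≢0 m = factor≢0 (rescaling-derivs m) zeros

    κ⁻¹ : Vec ℕ n → ℚ
    κ⁻¹ m = 1/_ (κ m) {{≢-nonZero (κ≢0 m)}}

    κ⁻¹*κ : ∀ m → κ⁻¹ m * κ m ≡ 1ℚ
    κ⁻¹*κ m = ℚₚ.*-inverseˡ (κ m) {{≢-nonZero (κ≢0 m)}}

    evalAt0-derivs : ∀ m (R : Poly n) → evalAt0 (derivs m R) ≡ κ m * coeff R m
    evalAt0-derivs m R = trans (coeff-T (rescaling-derivs m) R zeros) (cong (λ x → κ m * coeff R x) (raiseAll-zeros m))

  -- The values ⟨x^m, R⟩, which make the scalar product with R a linear functional.
  pairing : Poly n → Vec ℕ n → ℚ
  pairing R m = κ m * coeff R m

  ⟨⟩-ev : ∀ P R → ⟨ P , R ⟩ ≡ ev (pairing R) P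
  ⟨⟩-ev []            R = refl
  ⟨⟩-ev ((c , m) ∷ P) R = trans (coeff-++ (scale c (derivs m R)) (applyOp P R) zeros) (cong₂ _+_
    (trans (coeff-ev (scale c (derivs m R)) zeros) (trans (ev-scale (δ zeros) c (derivs m R))
      (cong (c *_) (trans (sym (coeff-ev (derivs m R) zeros)) (evalAt0-derivs m R)))))
    (⟨⟩-ev P R))

  ev-lincomb : ∀ {k} φ (cs : Vec ℚ k) (bs : Vec (Poly n) k) → ev φ (lincomb cs bs) ≡ ∑ (λ i → V.lookup cs i * ev φ (V.lookup bs i))
  ev-lincomb φ []       []       = refl
  ev-lincomb φ (c ∷ cs) (b ∷ bs) = trans (ev-++ φ (scale c b) (lincomb cs bs)) (cong₂ _+_ (ev-scale φ c b) (ev-lincomb φ cs bs))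

  ev-lincomb-tabulate : ∀ {k} φ (cs : Vec ℚ k) (b : Fin k → Poly n) →
                        ev φ (lincomb cs (V.tabulate b)) ≡ ∑ (λ i → V.lookup cs i * ev φ (b i))
  ev-lincomb-tabulate φ cs b = trans (ev-lincomb φ cs (V.tabulate b))
    (sum-cong-≗ λ i → cong (λ p → V.lookup cs i * ev φ p) (Vₚ.lookup∘tabulate b i))

-- The bases of Rₙ and SHₙ

kron-sym : ∀ {k} (i j : Fin k) → kron i j ≡ kron j i
kron-sym zero    zero    = refl
kron-sym zero    (suc j) = refl
kron-sym (suc i) zero    = refl
kron-sym (suc i) (suc j) = kron-sym i j

module _ {n k : ℕ} (D : DualPair n k) where
  open DualPair D renaming (reduction to R₀)

  basisR : Vec (Poly n) k
  basisR = V.tabulate (mono ∘ f R₀)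

  -- The functionals π kill 𝒥ₙ and are dual to the monomials, so they recover the coefficients of a
  -- combination; conversely every P is congruent to its reduction.
  isBasisR : IsBasisR n basisR
  isBasisR = independent , spanning
    where
    independent : ∀ cs → InJ n (lincomb cs basisR) → ∀ i → V.lookup cs i ≡ 0ℚ
    independent cs h i = begin
      V.lookup cs i
        ≡⟨ ∑-kron i (V.lookup cs) ⟨
      ∑ (λ j → kron i j * V.lookup cs j)
        ≡⟨ (sum-cong-≗ λ j → trans (ℚₚ.*-comm (kron i j) (V.lookup cs j)) (cong (V.lookup cs j *_)
             (trans (kron-sym i j) (sym (trans (ev-mono (λ m → π R₀ m i) (f R₀ j)) (π-f j i)))))) ⟩
      ∑ (λ j → V.lookup cs j * ev (λ m → π R₀ m i) (mono (f R₀ j)))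
        ≡⟨ ev-lincomb-tabulate (λ m → π R₀ m i) cs (mono ∘ f R₀) ⟨
      π* R₀ (lincomb cs basisR) i
        ≡⟨ π-J {lincomb cs basisR} (inJ h) i ⟩
      0ℚ ∎
      where open ≡-Reasoning
    spanning : ∀ P → ∃[ cs ] InJ n (P ⊕ negP (lincomb cs basisR))
    spanning P = V.tabulate (π* R₀ P) , InJ-J (J-⊖ (~-trans (π*-~ R₀ P) (≋⇒~ λ φ → trans (ev-fcomb φ (f R₀) (π* R₀ P))
      (sym (trans (ev-lincomb-tabulate φ (V.tabulate (π* R₀ P)) (mono ∘ f R₀))
        (sum-cong-≗ λ i → cong₂ _*_ (Vₚ.lookup∘tabulate (π* R₀ P) i) (ev-mono φ (f R₀ i))))))))

  -- Dividing by κ m turns the functional π into a polynomial that represents it under the scalar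
  -- product; `π-high` makes the sum finite.
  dualPoly : ∀ i → ∃[ R ] (∀ m → coeff R m ≡ π R₀ m i * κ⁻¹ m)
  dualPoly i = fromCoeff n n (λ m → π R₀ m i * κ⁻¹ m) λ m le →
    trans (cong (_* κ⁻¹ m) (π-high R₀ m le i)) (ℚₚ.*-zeroˡ (κ⁻¹ m))

  basisSH : Vec (Poly n) k
  basisSH = V.tabulate (proj₁ ∘ dualPoly)

  pairing-dual : ∀ i m → pairing (proj₁ (dualPoly i)) m ≡ π R₀ m i
  pairing-dual i m = trans (cong (κ m *_) (proj₂ (dualPoly i) m)) (trans
    (solve 3 (λ a p b → a :* (p :* b) := p :* (b :* a)) refl (κ m) (π R₀ m i) (κ⁻¹ m))
    (trans (cong (π R₀ m i *_) (κ⁻¹*κ m)) (ℚₚ.*-identityʳ (π R₀ m i))))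

  coeff-lincomb-SH : ∀ cs m → coeff (lincomb cs basisSH) m ≡ ∑ (λ i → V.lookup cs i * π R₀ m i) * κ⁻¹ m
  coeff-lincomb-SH cs m = trans (coeff-ev (lincomb cs basisSH) m) (trans (ev-lincomb-tabulate (δ m) cs (proj₁ ∘ dualPoly))
    (trans (sum-cong-≗ λ i → trans (cong (V.lookup cs i *_) (trans (sym (coeff-ev (proj₁ (dualPoly i)) m)) (proj₂ (dualPoly i) m)))
                                   (sym (ℚₚ.*-assoc (V.lookup cs i) (π R₀ m i) (κ⁻¹ m))))
           (sym (*-distribʳ-sum (κ⁻¹ m) (λ i → V.lookup cs i * π R₀ m i)))))

  orthogonalSH : ∀ i → InSH n (V.lookup basisSH i)
  orthogonalSH i P h = trans (cong (λ R → ⟨ P , R ⟩) (Vₚ.lookup∘tabulate (proj₁ ∘ dualPoly) i))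
    (trans (⟨⟩-ev P (proj₁ (dualPoly i))) (trans (ev-cong (pairing-dual i) P) (π-J {P} (inJ h) i)))

  -- By duality the coefficient of the combination at f i is c / κ (f i), with c its i-th scalar.
  independentSH : ∀ cs → lincomb cs basisSH ≈ₚ zeroP → ∀ i → V.lookup cs i ≡ 0ℚ
  independentSH cs h i = begin
    c                           ≡⟨ ℚₚ.*-identityʳ c ⟨
    c * 1ℚ                      ≡⟨ cong (c *_) (κ⁻¹*κ (f R₀ i)) ⟨
    c * (κ⁻¹ (f R₀ i) * κ (f R₀ i))   ≡⟨ ℚₚ.*-assoc c (κ⁻¹ (f R₀ i)) (κ (f R₀ i)) ⟨
    c * κ⁻¹ (f R₀ i) * κ (f R₀ i)     ≡⟨ cong (_* κ (f R₀ i)) c*κ⁻¹≡0 ⟩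
    0ℚ * κ (f R₀ i)                ≡⟨ ℚₚ.*-zeroˡ (κ (f R₀ i)) ⟩
    0ℚ                          ∎
    where
    open ≡-Reasoning
    c = V.lookup cs i
    c*κ⁻¹≡0 : c * κ⁻¹ (f R₀ i) ≡ 0ℚ
    c*κ⁻¹≡0 = trans (cong (_* κ⁻¹ (f R₀ i)) (trans (sym (∑-kron i (V.lookup cs)))
        (sum-cong-≗ λ j → trans (ℚₚ.*-comm (kron i j) (V.lookup cs j)) (cong (V.lookup cs j *_) (sym (π-f i j))))))
      (trans (sym (coeff-lincomb-SH cs (f R₀ i))) (h (f R₀ i)))

  -- The functional ⟨·, R⟩ vanishes on 𝒥ₙ, so it is determined by its values at the x^{f i}; these
  -- values are the coordinates of R.
  spanningSH : ∀ R → InSH n R → ∃[ cs ] (R ≈ₚ lincomb cs basisSH)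
  spanningSH R h = V.tabulate (pairing R ∘ f R₀) , λ m → begin
    coeff R m
      ≡⟨ ℚₚ.*-identityˡ (coeff R m) ⟨
    1ℚ * coeff R m
      ≡⟨ cong (_* coeff R m) (κ⁻¹*κ m) ⟨
    κ⁻¹ m * κ m * coeff R m
      ≡⟨ solve 3 (λ a b c → a :* b :* c := (b :* c) :* a) refl (κ⁻¹ m) (κ m) (coeff R m) ⟩
    pairing R m * κ⁻¹ m
      ≡⟨ cong (_* κ⁻¹ m) (trans (sym (ev-mono (pairing R) m)) (trans (reduce m) (ev-fcomb (pairing R) (f R₀) (π R₀ m)))) ⟩
    ∑ (λ i → π R₀ m i * pairing R (f R₀ i)) * κ⁻¹ m
      ≡⟨ cong (_* κ⁻¹ m) (sum-cong-≗ λ i → trans (ℚₚ.*-comm (π R₀ m i) (pairing R (f R₀ i)))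
           (cong (_* π R₀ m i) (sym (Vₚ.lookup∘tabulate (pairing R ∘ f R₀) i)))) ⟩
    ∑ (λ i → V.lookup (V.tabulate (pairing R ∘ f R₀)) i * π R₀ m i) * κ⁻¹ m
      ≡⟨ coeff-lincomb-SH (V.tabulate (pairing R ∘ f R₀)) m ⟨
    coeff (lincomb (V.tabulate (pairing R ∘ f R₀)) basisSH) m ∎
    where
    open ≡-Reasoning
    reduce : ∀ m → ev (pairing R) (mono m) ≡ ev (pairing R) (fcomb (f R₀) (π R₀ m))
    reduce m = -≡0⇒≡ (trans (sym (ev-⊖ (pairing R) (mono m) (fcomb (f R₀) (π R₀ m))))
      (trans (sym (⟨⟩-ev (mono m ⊕ negP (fcomb (f R₀) (π R₀ m))) R))
             (h (mono m ⊕ negP (fcomb (f R₀) (π R₀ m))) (InJ-J (J-⊖ (π-~ R₀ m))))))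

  isBasisSH : IsBasisSH n basisSH
  isBasisSH = orthogonalSH , independentSH , spanningSH

theorem1p2 : (n : ℕ) → 1 ≤ n →
    ∃[ m ] (m ≤ catalan n ×
    Σ (Vec (Poly n) m) (IsBasisR n) ×
    Σ (Vec (Poly n) m) (IsBasisSH n))
theorem1p2 (suc n) _ = map₂
  (λ (k≤ , D) → ℕₚ.≤-trans k≤ (ℕₚ.≤-reflexive (trans (length-dyck (suc n) 0) (ballot-catalan n))) ,
                (basisR D , isBasisR D) , (basisSH D , isBasisSH D))
  (dual-pair n)
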